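{- For $n\ge 0$ and $d\ge 1$, we have 1. $\operatorname{maxroot}\big(C_d^{(n+1)}\big)\le \gamma_{n/d}$; 2. for all $x>\gamma_{n/d}$, $$\mathcal{G}_{C_d^{(n+1)}}(x)\le \frac{ -nx+\sqrt{(n+d)^2(x^2-1)+n^2}}{d(x^2-1)},$$ where $\gamma_{n/d}=\sqrt{1-\frac{n^2}{(n+d)^2}}$.
   Context: Here $n$ and $d$ are integers. For real $a>0$, the Gegenbauer polynomials $C_m^{(a)}(x)$ are defined by $\sum_{m\ge 0}C_m^{(a)}(x)t^m=(1-2xt+t^2)^{ -a}$. For a nonconstant polynomial $p$, its Cauchy transform is $\mathcal{G}_p(x)=\frac{1}{\deg p}\,\frac{p'(x)}{p(x)}$, and $\operatorname{maxroot}(p)$ is its largest real root. The apparent singularity of the bound in part 2 at $x=1$ is removable: the right-hand side can equivalently be written as $\frac{2n+d}{nx+\sqrt{(n+d)^2(x^2-1)+n^2}}$. -}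

module Defs where

open import Algebra.Apartness.Structures using (IsHeytingField)
open import Algebra.Bundles using (CommutativeRing)
open import Algebra.Core using (Op₁; Op₂)
import Algebra.Properties.Ring as RingProperties
import Algebra.Solver.Ring.NaturalCoefficients.Default as SemiringSolver
open import Data.List.Base using (List; []; _∷_; map; foldr; upTo)
open import Data.Nat.Base as ℕ using (ℕ; zero; suc; NonZero; _∸_)
open import Data.Nat.GeneralisedArithmetic using (fold)
import Data.Nat.Properties as ℕ
open import Data.Product.Base using (∃; Σ-syntax; _×_; _,_; proj₁; proj₂)
open import Data.Sum.Base using (_⊎_; inj₁; inj₂)
open import Level using (0ℓ)
open import Relation.Binary.Core using (Rel)
open import Relation.Binary.Definitions using (Asymmetric; Cotransitive)
open import Relation.Nullary.Negation using (¬_; contradiction)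

-- The real numbers, axiomatised as a complete Archimedean ordered field.
-- These are D. Bridges's axioms for the constructive real line; given
-- excluded middle the locatedness hypothesis of `complete` always holds,
-- and they become the usual axioms of a Dedekind-complete ordered field,
-- which determine ℝ up to unique isomorphism.

record RealNumbers : Set₁ where
  infix  8 -_
  infixl 7 _*_
  infixl 6 _+_
  infix  4 _≈_ _<_ _≤_ _#_
  field
    ℝ       : Set
    _≈_ _<_ : Rel ℝ 0ℓ
    _+_ _*_ : Op₂ ℝ
    -_      : Op₁ ℝ
    0# 1#   : ℝ

  _#_ : Rel ℝ 0ℓ
  x # y = x < y ⊎ y < x

  _≤_ : Rel ℝ 0ℓ
  x ≤ y = ¬ (y < x)

  IsUpperBound : (ℝ → Set) → ℝ → Set
  IsUpperBound S b = ∀ s → S s → s ≤ b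

  IsSupremum : (ℝ → Set) → ℝ → Set
  IsSupremum S b = IsUpperBound S b × (∀ x → x < b → Σ[ s ∈ ℝ ] S s × x < s)

  ι : ℕ → ℝ
  ι n = fold 0# (1# +_) n

  field
    isHeytingField : IsHeytingField _≈_ _#_ _+_ _*_ -_ 0# 1#
    <-asym         : Asymmetric _<_
    <-cotrans      : Cotransitive _<_
    +-monoʳ-<      : ∀ z {x y} → x < y → z + x < z + y
    *-pos          : ∀ {x y} → 0# < x → 0# < y → 0# < x * y
    archimedean    : ∀ x → Σ[ n ∈ ℕ ] x < ι n
    complete       : ∀ (S : ℝ → Set) → ∃ S → ∃ (IsUpperBound S) →
                     (∀ x y → x < y → (Σ[ s ∈ ℝ ] S s × x < s) ⊎ IsUpperBound S y) →
                     ∃ (IsSupremum S)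

  open IsHeytingField isHeytingField public

  commutativeRing : CommutativeRing 0ℓ 0ℓ
  commutativeRing = record { isCommutativeRing = isCommutativeRing }

module OrderedFieldProperties (R : RealNumbers) where
  open RealNumbers R
  open CommutativeRing commutativeRing using (ring; commutativeSemiring)
  open RingProperties ring using (-‿distribʳ-*; -‿involutive)
  open SemiringSolver commutativeSemiring using (solve; _:=_; _:+_; _:*_; con)

  <⇒≉ : ∀ {x y} → x < y → ¬ (x ≈ y)
  <⇒≉ x<y x≈y = proj₂ (tight _ _) x≈y (inj₁ x<y)

  <-irrefl : ∀ {x} → ¬ (x < x)
  <-irrefl x<x = <-asym x<x x<x

  <-respʳ : ∀ {x y z} → y ≈ z → x < y → x < z
  <-respʳ {z = z} y≈z x<y with <-cotrans x<y z
  ... | inj₁ x<z = x<z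
  ... | inj₂ z<y = contradiction (sym y≈z) (<⇒≉ z<y)

  <-respˡ : ∀ {x y z} → x ≈ y → x < z → y < z
  <-respˡ {y = y} x≈y x<z with <-cotrans x<z y
  ... | inj₁ x<y = contradiction x≈y (<⇒≉ x<y)
  ... | inj₂ y<z = y<z

  <-trans : ∀ {x y z} → x < y → y < z → x < z
  <-trans {z = z} x<y y<z with <-cotrans x<y z
  ... | inj₁ x<z = x<z
  ... | inj₂ z<y = contradiction z<y (<-asym y<z)

  <-≤-trans : ∀ {x y z} → x < y → y ≤ z → x < z
  <-≤-trans {z = z} x<y y≤z with <-cotrans x<y z
  ... | inj₁ x<z = x<z
  ... | inj₂ z<y = contradiction z<y y≤z

  ≤-<-trans : ∀ {x y z} → x ≤ y → y < z → x < z
  ≤-<-trans {x} x≤y y<z with <-cotrans y<z x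
  ... | inj₁ y<x = contradiction y<x x≤y
  ... | inj₂ x<z = x<z

  ≤-antisym : ∀ {x y} → x ≤ y → y ≤ x → x ≈ y
  ≤-antisym x≤y y≤x = proj₁ (tight _ _) λ
    { (inj₁ x<y) → y≤x x<y
    ; (inj₂ y<x) → x≤y y<x }

  pos⇒#0 : ∀ {x} → 0# < x → x # 0#
  pos⇒#0 = inj₂

  +-monoˡ-< : ∀ z {x y} → x < y → x + z < y + z
  +-monoˡ-< z x<y = <-respˡ (+-comm z _) (<-respʳ (+-comm z _) (+-monoʳ-< z x<y))

  x<x+y : ∀ {x y} → 0# < y → x < x + y
  x<x+y {x} 0<y = <-respˡ (+-identityʳ x) (+-monoʳ-< x 0<y)

  y<x+y : ∀ {x y} → 0# < x → y < x + y
  y<x+y {x} {y} 0<x = <-respʳ (+-comm y x) (x<x+y 0<x)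

  y-x+x : ∀ x y → x + (y - x) ≈ y
  y-x+x x y = trans (+-comm x _)
    (trans (+-assoc y _ x) (trans (+-congˡ (-‿inverseˡ x)) (+-identityʳ y)))

  <⇒0<- : ∀ {x y} → x < y → 0# < y - x
  <⇒0<- {x} x<y = <-respˡ (-‿inverseʳ x) (+-monoˡ-< (- x) x<y)

  *-monoʳ-< : ∀ {z x y} → 0# < z → x < y → z * x < z * y
  *-monoʳ-< {z} {x} {y} 0<z x<y =
    <-respʳ (trans (sym (distribˡ z x _)) (*-congˡ (y-x+x x y)))
            (x<x+y (*-pos 0<z (<⇒0<- x<y)))

  *-monoˡ-< : ∀ {z x y} → 0# < z → x < y → x * z < y * z
  *-monoˡ-< {z} 0<z x<y =
    <-respˡ (*-comm z _) (<-respʳ (*-comm z _) (*-monoʳ-< 0<z x<y))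

  sq-mono-< : ∀ {x y} → 0# < x → x < y → x * x < y * y
  sq-mono-< 0<x x<y = <-trans (*-monoʳ-< 0<x x<y) (*-monoˡ-< (<-trans 0<x x<y) x<y)

  1#0 : 1# # 0#
  1#0 = invertible⇒# (1# , 1*[1-0] , trans (*-comm _ 1#) 1*[1-0])
    where
    1-0 : 1# - 0# ≈ 1#
    1-0 = trans (sym (+-identityˡ _)) (y-x+x 0# 1#)
    1*[1-0] : 1# * (1# - 0#) ≈ 1#
    1*[1-0] = trans (*-congˡ 1-0) (*-identityʳ 1#)

  0<1 : 0# < 1#
  0<1 with 1#0
  ... | inj₂ 0<1 = 0<1
  ... | inj₁ 1<0 = contradiction
        (<-respʳ (trans (sym (-‿distribʳ-* _ 1#)) (trans (-‿cong (*-identityʳ _)) (-‿involutive 1#))) (*-pos 0<-1 0<-1))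
        (<-asym 1<0)
    where
    0<-1 : 0# < - 1#
    0<-1 = <-respʳ (+-identityˡ _) (<⇒0<- 1<0)

  infixl 7 _/_⟨_⟩
  _/_⟨_⟩ : (x y : ℝ) → y # 0# → ℝ
  x / y ⟨ y#0 ⟩ = x * proj₁ (#⇒invertible y#0)

  /-* : ∀ x y (y#0 : y # 0#) → (x / y ⟨ y#0 ⟩) * y ≈ x
  /-* x y y#0 with #⇒invertible y#0
  ... | y⁻¹ , y⁻¹*[y-0] , _ = trans (*-assoc x y⁻¹ y)
        (trans (*-congˡ (trans (*-congˡ y≈y-0) y⁻¹*[y-0])) (*-identityʳ x))
    where
    y≈y-0 : y ≈ y - 0#
    y≈y-0 = trans (sym (y-x+x 0# y)) (+-identityˡ _)

  0</ : ∀ {x y} → 0# < x → (0<y : 0# < y) → 0# < x / y ⟨ pos⇒#0 0<y ⟩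
  0</ {x} {y} 0<x 0<y with #⇒invertible (pos⇒#0 0<y)
  ... | y⁻¹ , y⁻¹*[y-0] , _ = *-pos 0<x 0<y⁻¹
    where
    -0≈ : ∀ z → z - 0# ≈ z
    -0≈ z = trans (sym (+-identityˡ _)) (y-x+x 0# z)
    y⁻¹*y : y⁻¹ * y ≈ 1#
    y⁻¹*y = trans (*-congˡ (sym (-0≈ y))) y⁻¹*[y-0]
    y*[y⁻¹-0] : y * (y⁻¹ - 0#) ≈ 1#
    y*[y⁻¹-0] = trans (*-congˡ (-0≈ y⁻¹)) (trans (*-comm y y⁻¹) y⁻¹*y)
    0<y⁻¹ : 0# < y⁻¹
    0<y⁻¹ with invertible⇒# (y , y*[y⁻¹-0] , trans (*-comm _ y) y*[y⁻¹-0])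
    ... | inj₂ 0<y⁻¹ = 0<y⁻¹
    ... | inj₁ y⁻¹<0 = contradiction
          (<-respˡ (trans (*-comm y y⁻¹) y⁻¹*y)
            (<-respʳ (zeroʳ y) (*-monoʳ-< 0<y y⁻¹<0)))
          (<-asym 0<1)

  *-cancelʳ-< : ∀ {x y z} → 0# < z → x * z < y * z → x < y
  *-cancelʳ-< {x} {y} {z} 0<z xz<yz =
    <-respˡ (undo x) (<-respʳ (undo y) (*-monoˡ-< (0</ 0<1 0<z) xz<yz))
    where
    z⁻¹ = 1# / z ⟨ pos⇒#0 0<z ⟩
    undo : ∀ w → w * z * z⁻¹ ≈ w
    undo w = trans (*-assoc w z z⁻¹)
      (trans (*-congˡ (trans (*-comm z z⁻¹) (/-* 1# z _))) (*-identityʳ w))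

  0<2 : 0# < 1# + 1#
  0<2 = <-trans 0<1 (x<x+y 0<1)

  ½ : ℝ
  ½ = 1# / 1# + 1# ⟨ pos⇒#0 0<2 ⟩

  0<½ : 0# < ½
  0<½ = 0</ 0<1 0<2

  ½x+½x : ∀ x → ½ * x + ½ * x ≈ x
  ½x+½x x = trans (sym (distribʳ x ½ ½)) (trans (*-congʳ ½+½) (*-identityˡ x))
    where
    ½+½ : ½ + ½ ≈ 1#
    ½+½ = trans (sym (trans (distribˡ ½ 1# 1#) (+-cong (*-identityʳ ½) (*-identityʳ ½))))
                (/-* 1# (1# + 1#) _)

  <-dense : ∀ {x y} → x < y → Σ[ z ∈ ℝ ] x < z × z < y
  <-dense {x} {y} x<y = x + h , x<x+y 0<h ,
    <-respʳ (trans (+-congˡ (½x+½x (y - x))) (y-x+x x y)) (+-monoʳ-< x (x<x+y 0<h))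
    where
    h = ½ * (y - x)
    0<h : 0# < h
    0<h = *-pos 0<½ (<⇒0<- x<y)

  0<ι : ∀ n .{{_ : NonZero n}} → 0# < ι n
  0<ι (suc zero)    = <-respʳ (sym (+-identityʳ 1#)) 0<1
  0<ι (suc (suc n)) = <-trans 0<1 (x<x+y (0<ι (suc n)))

  ι#0 : ∀ n .{{_ : NonZero n}} → ι n # 0#
  ι#0 n = pos⇒#0 (0<ι n)

-- The square root, extended by 0 to negative arguments.

module SquareRoot (R : RealNumbers) where
  open RealNumbers R
  open OrderedFieldProperties R
  open CommutativeRing commutativeRing using (commutativeSemiring)
  open SemiringSolver commutativeSemiring using (solve; _:=_; _:+_; _:*_; con)

  private
    Below : ℝ → ℝ → Set
    Below a s = s < 0# ⊎ s * s < a

    upper : ∀ {a b} → 0# < b → a < b * b → IsUpperBound (Below a) b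
    upper 0<b a<b² s (inj₁ s<0)  b<s = <-asym (<-trans 0<b b<s) s<0
    upper 0<b a<b² s (inj₂ s²<a) b<s =
      <-irrefl (<-trans (sq-mono-< 0<b b<s) (<-trans s²<a a<b²))

    inhabited : ∀ a → ∃ (Below a)
    inhabited a = - 1# , inj₁ (<-respˡ (+-identityˡ _) (<-respʳ (-‿inverseʳ 1#) (+-monoˡ-< (- 1#) 0<1)))

    bounded : ∀ a → ∃ (IsUpperBound (Below a))
    bounded a with <-cotrans 0<1 a
    ... | inj₂ a<1 = 1# , upper 0<1 (<-respʳ (sym (*-identityˡ 1#)) a<1)
    ... | inj₁ 0<a = 1# + a , upper 0<1+a
          (<-trans (y<x+y 0<1) (<-respˡ (*-identityʳ _) (*-monoʳ-< 0<1+a (x<x+y 0<a))))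
      where
      0<1+a : 0# < 1# + a
      0<1+a = <-trans 0<1 (x<x+y 0<a)

    Located : ℝ → ℝ → ℝ → Set
    Located a x y = (Σ[ s ∈ ℝ ] Below a s × x < s) ⊎ IsUpperBound (Below a) y

    located⁺ : ∀ {a x y z} → 0# < z → z < y → (∀ {s} → z < s → x < s) → Located a x y
    located⁺ {a} 0<z z<y z<⇒x< with <-dense z<y
    ... | s , z<s , s<y with <-cotrans (sq-mono-< (<-trans 0<z z<s) s<y) a
    ...   | inj₁ s²<a = inj₁ (s , inj₂ s²<a , z<⇒x< z<s)
    ...   | inj₂ a<y² = inj₂ (upper (<-trans 0<z z<y) a<y²)

    located : ∀ a x y → x < y → Located a x y
    located a x y x<y with <-cotrans x<y 0#
    ... | inj₁ x<0 = let s , x<s , s<0 = <-dense x<0 in inj₁ (s , inj₁ s<0 , x<s)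
    ... | inj₂ 0<y with <-dense 0<y
    ...   | m , 0<m , m<y with <-cotrans 0<m x
    ...     | inj₁ 0<x = located⁺ 0<x x<y (λ x<s → x<s)
    ...     | inj₂ x<m = located⁺ 0<m m<y (<-trans x<m)

    supremum : ∀ a → ∃ (IsSupremum (Below a))
    supremum a = complete (Below a) (inhabited a) (bounded a) (located a)

  infix 9 √_
  √_ : ℝ → ℝ
  √ a = proj₁ (supremum a)

  √-nonneg : ∀ a → 0# ≤ √ a
  √-nonneg a √a<0 =
    let s , √a<s , s<0 = <-dense √a<0
    in proj₁ (proj₂ (supremum a)) s (inj₁ s<0) √a<s

  √-square : ∀ {a} → 0# ≤ a → √ a * √ a ≈ a
  √-square {a} 0≤a = ≤-antisym b²≯a b²≮a
    where
    b = √ a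
    0≤b = √-nonneg a

    b²≮a : ¬ (b * b < a)
    b²≮a b²<a = proj₁ (proj₂ (supremum a)) (b + e) (inj₂ [b+e]²<a) (x<x+y 0<e)
      where
      δ = a - b * b
      0<δ : 0# < δ
      0<δ = <⇒0<- b²<a
      K = 1# + (b + b)
      1≤K : 1# ≤ K
      1≤K K<1 = 0≤b+b (<-respˡ -1+K (<-respʳ (-‿inverseˡ 1#) (+-monoʳ-< (- 1#) K<1)))
        where
        -1+K : - 1# + K ≈ b + b
        -1+K = trans (sym (+-assoc _ _ _)) (trans (+-congʳ (-‿inverseˡ 1#)) (+-identityˡ _))
        0≤b+b : 0# ≤ b + b
        0≤b+b 2b<0 with <-cotrans 2b<0 b
        ... | inj₂ b<0  = 0≤b b<0
        ... | inj₁ 2b<b = 0≤b (<-respˡ (trans (sym (+-assoc _ _ _)) (trans (+-congʳ (-‿inverseˡ b)) (+-identityˡ b)))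
                                 (<-respʳ (-‿inverseˡ b) (+-monoʳ-< (- b) 2b<b)))
      0<K : 0# < K
      0<K = <-≤-trans 0<1 1≤K
      D = K + δ
      0<D : 0# < D
      0<D = <-trans 0<K (x<x+y 0<δ)
      e = δ / D ⟨ pos⇒#0 0<D ⟩
      0<e : 0# < e
      0<e = 0</ 0<δ 0<D
      eD≈δ : e * D ≈ δ
      eD≈δ = /-* δ D _
      e<1 : e < 1#
      e<1 = *-cancelʳ-< 0<D (<-respˡ (sym eD≈δ) (<-respʳ (sym (*-identityˡ D)) (y<x+y 0<K)))
      [b+e]²<a : (b + e) * (b + e) < a
      [b+e]²<a = <-respˡ expand (<-respʳ (trans (+-congˡ eD≈δ) (y-x+x (b * b) a)) (+-monoʳ-< (b * b) small))
        where
        expand : b * b + e * (b + b + e) ≈ (b + e) * (b + e)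
        expand = solve 2 (λ b e → b :* b :+ e :* (b :+ b :+ e) := (b :+ e) :* (b :+ e)) refl b e
        small : e * (b + b + e) < e * D
        small = *-monoʳ-< 0<e (<-trans (+-monoʳ-< (b + b) e<1)
                  (<-respˡ (+-comm 1# (b + b)) (x<x+y 0<δ)))

    b²≯a : ¬ (a < b * b)
    b²≯a a<b² = 0<b-absurd λ 0<b →
      let c = a / b ⟨ pos⇒#0 0<b ⟩
          cb≈a = /-* a b (pos⇒#0 0<b)
          c<b = *-cancelʳ-< {c} {b} 0<b (<-respˡ (sym cb≈a) a<b²)
          e = b - c
          h = ½ * e
          0<h = *-pos 0<½ (<⇒0<- c<b)
          c+2h≈b = trans (+-congˡ (½x+½x e)) (y-x+x c b)
          0≤c = λ c<0 → 0≤a (<-respˡ cb≈a (<-respʳ (zeroˡ b) (*-monoˡ-< 0<b c<0)))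
          0<c+h = ≤-<-trans 0≤c (x<x+y 0<h)
          c+h<b = <-respʳ c+2h≈b (+-monoʳ-< c (x<x+y 0<h))
          a<[c+h]² = <-respʳ (expand c h) (<-respˡ (trans (*-congˡ c+2h≈b) cb≈a) (x<x+y (*-pos 0<h 0<h)))
          s , s∈ , c+h<s = proj₂ (proj₂ (supremum a)) (c + h) c+h<b
      in upper 0<c+h a<[c+h]² s s∈ c+h<s
      where
      expand : ∀ c h → c * (c + (h + h)) + h * h ≈ (c + h) * (c + h)
      expand = solve 2 (λ c h → c :* (c :+ (h :+ h)) :+ h :* h := (c :+ h) :* (c :+ h)) refl
      0<b-absurd : ¬ ¬ (0# < b)
      0<b-absurd 0≮b = 0≤a (<-respʳ (trans (*-congˡ (≤-antisym 0≮b 0≤b)) (zeroʳ b)) a<b²)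

module Polynomials (R : RealNumbers) where
  open RealNumbers R
  open OrderedFieldProperties R

  -- Coefficient lists, constant term first; trailing zeros are allowed.
  Poly : Set
  Poly = List ℝ

  infixl 6 _⊕_
  infixl 7 _⊗_ _·_

  _⊕_ : Poly → Poly → Poly
  []      ⊕ q       = q
  (a ∷ p) ⊕ []      = a ∷ p
  (a ∷ p) ⊕ (b ∷ q) = a + b ∷ p ⊕ q

  _·_ : ℝ → Poly → Poly
  c · p = map (c *_) p

  _⊗_ : Poly → Poly → Poly
  []      ⊗ q = []
  (a ∷ p) ⊗ q = a · q ⊕ (0# ∷ p ⊗ q)

  ⟦_⟧ : Poly → ℝ → ℝ
  ⟦ []    ⟧ x = 0#
  ⟦ a ∷ p ⟧ x = a + x * ⟦ p ⟧ x

  -- (a + x p)′ = p + x p′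
  _′ : Poly → Poly
  []      ′ = []
  (a ∷ p) ′ = p ⊕ (0# ∷ p ′)

  coeff : Poly → ℕ → ℝ
  coeff []      k       = 0#
  coeff (a ∷ p) zero    = a
  coeff (a ∷ p) (suc k) = coeff p k

  record Nonconstant (p : Poly) : Set where
    field
      deg         : ℕ
      {{deg≢0}}   : NonZero deg
      leading     : coeff p deg # 0#
      beyond      : ∀ k → deg ℕ.< k → coeff p k ≈ 0#

  IsMaxRoot : Poly → ℝ → Set
  IsMaxRoot p r = ⟦ p ⟧ r ≈ 0# × (∀ s → ⟦ p ⟧ s ≈ 0# → s ≤ r)

  𝒢 : (p : Poly) → Nonconstant p → (x : ℝ) → ⟦ p ⟧ x # 0# → ℝ
  𝒢 p nc x p[x]#0 = (1# / ι deg ⟨ ι#0 deg ⟩) * (⟦ p ′ ⟧ x / ⟦ p ⟧ x ⟨ p[x]#0 ⟩)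
    where open Nonconstant nc

-- The generating function (1 - 2xt + t²)^(-a) is a formal power series in t
-- with coefficients in ℝ[x].

module Gegenbauer (R : RealNumbers) where
  open RealNumbers R
  open OrderedFieldProperties R
  open Polynomials R
  open SquareRoot R

  Series : Set
  Series = ℕ → Poly

  ∑[0⋯_] : ℕ → (ℕ → Poly) → Poly
  ∑[0⋯ m ] f = foldr _⊕_ [] (map f (upTo (suc m)))

  one : Series
  one zero    = 1# ∷ []
  one (suc _) = []

  infixl 7 _⊛_
  _⊛_ : Series → Series → Series
  (f ⊛ g) m = ∑[0⋯ m ] λ i → f i ⊗ g (m ∸ i)

  power : Series → ℕ → Series
  power f zero    = one
  power f (suc k) = f ⊛ power f k

  -- The generalised binomial coefficient α (α - 1) ⋯ (α - k + 1) / k!.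
  binomial : ℝ → ℕ → ℝ
  binomial α zero    = 1#
  binomial α (suc k) = binomial α k * (α - ι k) / ι (suc k) ⟨ ι#0 (suc k) ⟩

  -- (1 + u)^α = ∑ₖ binomial α k · uᵏ for a series u without constant term;
  -- then uᵏ does not contribute to the coefficient of t^m once k > m.
  [1+_]^_ : Series → ℝ → Series
  ([1+ u ]^ α) m = ∑[0⋯ m ] λ k → binomial α k · power u k m

  -2xt+t² : Series
  -2xt+t² 1 = 0# ∷ - ι 2 ∷ []
  -2xt+t² 2 = 1# ∷ []
  -2xt+t² _ = []

  gegenbauer : ℝ → ℕ → Poly
  gegenbauer a m = ([1+ -2xt+t² ]^ (- a)) m

  ι[n+d]²#0 : ∀ n d .{{_ : NonZero d}} → ι (n ℕ.+ d) * ι (n ℕ.+ d) # 0#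
  ι[n+d]²#0 n d = pos⇒#0 (*-pos 0<n+d 0<n+d)
    where
    instance
      n+d≢0 : NonZero (n ℕ.+ d)
      n+d≢0 = ℕ.>-nonZero (ℕ.≤-trans (ℕ.>-nonZero⁻¹ d) (ℕ.m≤n+m d n))
    0<n+d : 0# < ι (n ℕ.+ d)
    0<n+d = 0<ι (n ℕ.+ d)

  -- γ_{n/d}; the formula depends on n and d through n/d only.
  γ : (n d : ℕ) .{{_ : NonZero d}} → ℝ
  γ n d = √ (1# - ι n * ι n / ι (n ℕ.+ d) * ι (n ℕ.+ d) ⟨ ι[n+d]²#0 n d ⟩)

-- Write C for the Gegenbauer polynomial of degree d and parameter n + 1, N = n + d and
-- S = √(N²(x² - 1) + n²). Both bounds say C′(x) (n x + S) ≤ d (d + 2n) C(x), and C(x) > 0 for x > γ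
-- gives the bound on the largest root. Up to constants C′ and C″ are the Gegenbauer polynomials for
-- (n + 1, d - 1) and (n + 2, d - 2), which have the same N, so for γ < x ≤ 1 the differential
-- equation, read as a recursion for C′/C in terms of C″/C′, proves both claims by induction on d.
-- For x > 1 the bound follows from a Turán inequality between C and the polynomial of degree d - 1,
-- which the three-term recurrence preserves. The largest root is constructed by induction on the
-- degree: by the Christoffel-Darboux identity, consecutive quotients are increasing beyond the
-- previous largest root.
module Submission where

open import Defs
open import Algebra.Bundles using (CommutativeRing)
import Algebra.Properties.AbelianGroup as AbelianGroupProperties
import Algebra.Properties.CommutativeSemigroup as CommutativeSemigroupProperties
import Algebra.Properties.Ring as RingProperties
import Algebra.Solver.Ring as RingSolver
open import Algebra.Solver.Ring.AlmostCommutativeRing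
  using (fromCommutativeRing; _-Raw-AlmostCommutative⟶_)
open import Data.Integer.Base as ℤ using (ℤ; +_; -[1+_]; sign; ∣_∣; _◃_; _⊖_)
import Data.Integer.Properties as ℤ
open import Data.List.Base using ([]; _∷_; map; foldr; applyUpTo)
open import Data.Maybe.Base as Maybe using (Maybe)
open import Data.Nat.Base as ℕ using (ℕ; zero; suc; NonZero; s≤s; _∸_)
import Data.Nat.Properties as ℕ
open import Data.Product.Base using (∃; Σ-syntax; _×_; _,_; proj₁; proj₂)
open import Data.Sign.Base as Sign using (Sign)
open import Data.Sum.Base using (_⊎_; inj₁; inj₂)
open import Relation.Binary.PropositionalEquality.Core as ≡ using (_≡_)
open import Relation.Nullary.Decidable.Core using (dec⇒maybe)
open import Relation.Nullary.Negation using (¬_)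

-- The bound on C′/C is u = d (d + 2n) / (n x + S), a root of (x² - 1) u² + 2 n x u = d (d + 2n),
-- and `γ` is the point where the radicand S² vanishes. The differential equation d (d + 2n + 2) C =
-- (2n + 3) x C′ - (1 - x²) C″ turns an upper bound on C″ into a lower bound on C only while x ≤ 1;
-- beyond 1 the last term changes sign, which forces another argument there. The induction is
-- carried out with denominators cleared, so x = 1 is an ordinary point. The order is not assumed
-- decidable. As `_≤_` is a negation, the split at x = 1 is available for weak inequalities, but
-- positivity of C is strict and has to come from a weak lower bound that holds on both sides of 1.
-- For the same reason the supremum that defines the largest root needs a proof of locatedness.

-- Integer constants in ℝ and a ring solver with subtraction.

module Naturals (R : RealNumbers) where
  open RealNumbers R hiding (zero)
  open CommutativeRing commutativeRing
    using (ring; +-abelianGroup; *-commutativeSemigroup)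
  open RingProperties ring
  open CommutativeSemigroupProperties *-commutativeSemigroup using (interchange)
  open AbelianGroupProperties +-abelianGroup using (⁻¹-∙-comm)

  ι-cong : ∀ {m n} → m ≡ n → ι m ≈ ι n
  ι-cong ≡.refl = refl

  ι-+ : ∀ m n → ι (m ℕ.+ n) ≈ ι m + ι n
  ι-+ zero    n = sym (+-identityˡ _)
  ι-+ (suc m) n = trans (+-congˡ (ι-+ m n)) (sym (+-assoc _ _ _))

  ι-* : ∀ m n → ι (m ℕ.* n) ≈ ι m * ι n
  ι-* zero    n = sym (zeroˡ _)
  ι-* (suc m) n = trans (ι-+ n (m ℕ.* n))
    (trans (+-cong (sym (*-identityˡ _)) (ι-* m n)) (sym (distribʳ _ _ _)))

  -- Unlike ι, sends 1 to 1# rather than 1# + 0#, so that the solver constant con (+ 1) denotes 1#.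
  ℕ⟦_⟧ : ℕ → ℝ
  ℕ⟦ zero ⟧        = 0#
  ℕ⟦ suc zero ⟧    = 1#
  ℕ⟦ suc (suc n) ⟧ = ι (suc (suc n))

  ℤ⟦_⟧ : ℤ → ℝ
  ℤ⟦ + n ⟧      = ℕ⟦ n ⟧
  ℤ⟦ -[1+ n ] ⟧ = - ℕ⟦ suc n ⟧

  ℕ⟦⟧≈ι : ∀ n → ℕ⟦ n ⟧ ≈ ι n
  ℕ⟦⟧≈ι zero          = refl
  ℕ⟦⟧≈ι (suc zero)    = sym (+-identityʳ 1#)
  ℕ⟦⟧≈ι (suc (suc n)) = refl

  private
    [1+a]-[1+b] : ∀ a b → a - b ≈ (1# + a) - (1# + b)
    [1+a]-[1+b] a b = sym (trans (+-cong (+-comm 1# a) (sym (⁻¹-∙-comm 1# b)))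
      (trans (+-assoc a 1# _) (+-congˡ
        (trans (sym (+-assoc 1# (- 1#) (- b))) (trans (+-congʳ (-‿inverseʳ 1#)) (+-identityˡ _))))))

    ⟦⊖⟧ : ∀ m n → ℤ⟦ m ⊖ n ⟧ ≈ ι m - ι n
    ⟦⊖⟧ zero    zero    = sym (-‿inverseʳ 0#)
    ⟦⊖⟧ zero    (suc n) = trans (-‿cong (ℕ⟦⟧≈ι (suc n))) (sym (+-identityˡ _))
    ⟦⊖⟧ (suc m) zero    = trans (ℕ⟦⟧≈ι (suc m)) (sym (trans (+-congˡ -0#≈0#) (+-identityʳ _)))
    ⟦⊖⟧ (suc m) (suc n) = trans (reflexive (≡.cong ℤ⟦_⟧ (ℤ.[1+m]⊖[1+n]≡m⊖n m n)))
      (trans (⟦⊖⟧ m n) ([1+a]-[1+b] (ι m) (ι n)))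

    σ : Sign → ℝ
    σ Sign.+ = 1#
    σ Sign.- = - 1#

    σ-* : ∀ s t → σ (s Sign.* t) ≈ σ s * σ t
    σ-* Sign.+ t      = sym (*-identityˡ _)
    σ-* Sign.- Sign.+ = sym (*-identityʳ _)
    σ-* Sign.- Sign.- = sym (trans (sym (-‿distribˡ-* _ _)) (trans (-‿cong (*-identityˡ _)) (-‿involutive 1#)))

    ⟦◃⟧ : ∀ s n → ℤ⟦ s ◃ n ⟧ ≈ σ s * ι n
    ⟦◃⟧ s      zero    = sym (zeroʳ _)
    ⟦◃⟧ Sign.+ (suc n) = trans (ℕ⟦⟧≈ι (suc n)) (sym (*-identityˡ _))
    ⟦◃⟧ Sign.- (suc n) = trans (-‿cong (trans (ℕ⟦⟧≈ι (suc n)) (sym (*-identityˡ _)))) (-‿distribˡ-* _ _)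

    ⟦⟧-sign : ∀ i → ℤ⟦ i ⟧ ≈ σ (sign i) * ι ∣ i ∣
    ⟦⟧-sign (+ n)      = trans (ℕ⟦⟧≈ι n) (sym (*-identityˡ _))
    ⟦⟧-sign -[1+ n ] = trans (-‿cong (trans (ℕ⟦⟧≈ι (suc n)) (sym (*-identityˡ _)))) (-‿distribˡ-* _ _)

  ℤ⟦⟧-+ : ∀ i j → ℤ⟦ i ℤ.+ j ⟧ ≈ ℤ⟦ i ⟧ + ℤ⟦ j ⟧
  ℤ⟦⟧-+ (+ m)    (+ n)    = trans (ℕ⟦⟧≈ι (m ℕ.+ n))
    (trans (ι-+ m n) (sym (+-cong (ℕ⟦⟧≈ι m) (ℕ⟦⟧≈ι n))))
  ℤ⟦⟧-+ (+ m)    -[1+ n ] = trans (⟦⊖⟧ m (suc n))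
    (sym (+-cong (ℕ⟦⟧≈ι m) (-‿cong (ℕ⟦⟧≈ι (suc n)))))
  ℤ⟦⟧-+ -[1+ m ] (+ n)    = trans (⟦⊖⟧ n (suc m))
    (trans (sym (+-cong (ℕ⟦⟧≈ι n) (-‿cong (ℕ⟦⟧≈ι (suc m))))) (+-comm _ _))
  ℤ⟦⟧-+ -[1+ m ] -[1+ n ] = trans (-‿cong (trans (ι-cong (≡.cong suc (≡.sym (ℕ.+-suc m n))))
    (trans (ι-+ (suc m) (suc n)) (sym (+-cong (ℕ⟦⟧≈ι (suc m)) (ℕ⟦⟧≈ι (suc n)))))))
    (sym (⁻¹-∙-comm _ _))

  ℤ⟦⟧-* : ∀ i j → ℤ⟦ i ℤ.* j ⟧ ≈ ℤ⟦ i ⟧ * ℤ⟦ j ⟧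
  ℤ⟦⟧-* i j = trans (⟦◃⟧ (sign i Sign.* sign j) (∣ i ∣ ℕ.* ∣ j ∣))
    (trans (*-cong (σ-* (sign i) (sign j)) (ι-* ∣ i ∣ ∣ j ∣))
    (trans (interchange _ _ _ _) (sym (*-cong (⟦⟧-sign i) (⟦⟧-sign j)))))

  ℤ⟦⟧-neg : ∀ i → ℤ⟦ ℤ.- i ⟧ ≈ - ℤ⟦ i ⟧
  ℤ⟦⟧-neg (+ zero)  = sym -0#≈0#
  ℤ⟦⟧-neg (+ suc n) = refl
  ℤ⟦⟧-neg -[1+ n ]  = sym (-‿involutive _)

  -- Integer coefficients have decidable equality, which ℝ does not; the solver needs it to cancel
  -- terms.
  ℤ-morphism : CommutativeRing.rawRing ℤ.+-*-commutativeRing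
               -Raw-AlmostCommutative⟶ fromCommutativeRing commutativeRing
  ℤ-morphism = record
    { ⟦_⟧    = ℤ⟦_⟧
    ; +-homo = ℤ⟦⟧-+
    ; *-homo = ℤ⟦⟧-*
    ; -‿homo = ℤ⟦⟧-neg
    ; 0-homo = refl
    ; 1-homo = refl
    }

  ℤ⟦⟧-weaklyDecidable : ∀ i j → Maybe (ℤ⟦ i ⟧ ≈ ℤ⟦ j ⟧)
  ℤ⟦⟧-weaklyDecidable i j = Maybe.map (λ i≡j → reflexive (≡.cong ℤ⟦_⟧ i≡j)) (dec⇒maybe (i ℤ.≟ j))

  module ℤSolver = RingSolver (CommutativeRing.rawRing ℤ.+-*-commutativeRing)
    (fromCommutativeRing commutativeRing) ℤ-morphism ℤ⟦⟧-weaklyDecidable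

-- Weak inequalities in a constructively ordered field.

module OrderedField (R : RealNumbers) where
  open RealNumbers R hiding (zero)
  open OrderedFieldProperties R
  open Naturals R
  open ℤSolver using (solve; _:=_; _:+_; _:*_; _:-_; :-_; con)

  <⇒≤ : ∀ {x y} → x < y → x ≤ y
  <⇒≤ = <-asym

  ≤-reflexive : ∀ {x y} → x ≈ y → x ≤ y
  ≤-reflexive x≈y y<x = <⇒≉ y<x (sym x≈y)

  ≤-trans : ∀ {x y z} → x ≤ y → y ≤ z → x ≤ z
  ≤-trans x≤y y≤z z<x = x≤y (≤-<-trans y≤z z<x)

  ≤-respʳ : ∀ {x y z} → y ≈ z → x ≤ y → x ≤ z
  ≤-respʳ y≈z x≤y z<x = x≤y (<-respˡ (sym y≈z) z<x)

  ≤-respˡ : ∀ {x y z} → x ≈ y → x ≤ z → y ≤ z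
  ≤-respˡ x≈y x≤z z<y = x≤z (<-respʳ (sym x≈y) z<y)

  -- Since _≤_ is a negation, inequalities may be proved by a classical case distinction.
  ≤-by-cases : ∀ x y {a b} → (x ≤ y → a ≤ b) → (y < x → a ≤ b) → a ≤ b
  ≤-by-cases x y p q b<a = p (λ y<x → q y<x b<a) b<a

  +-monoʳ-≤ : ∀ z {x y} → x ≤ y → z + x ≤ z + y
  +-monoʳ-≤ z {x} {y} x≤y z+y<z+x = x≤y (<-respˡ (undo y) (<-respʳ (undo x) (+-monoʳ-< (- z) z+y<z+x)))
    where
    undo : ∀ w → - z + (z + w) ≈ w
    undo = solve 2 (λ z w → :- z :+ (z :+ w) := w) refl z

  0≤+ : ∀ {x y} → 0# ≤ x → 0# ≤ y → 0# ≤ x + y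
  0≤+ {x} 0≤x 0≤y = ≤-trans 0≤x (≤-respˡ (+-identityʳ x) (+-monoʳ-≤ x 0≤y))

  0<+ : ∀ {x y} → 0# < x → 0# ≤ y → 0# < x + y
  0<+ {x} 0<x 0≤y = <-≤-trans 0<x (≤-respˡ (+-identityʳ x) (+-monoʳ-≤ x 0≤y))

  ≤⇒0≤- : ∀ {x y} → x ≤ y → 0# ≤ y - x
  ≤⇒0≤- {x} {y} x≤y = ≤-respˡ (-‿inverseˡ x) (≤-respʳ (+-comm (- x) y) (+-monoʳ-≤ (- x) x≤y))

  -- Certificate form of an inequality: name the slack `z`, show that it is nonnegative, and leave a
  -- polynomial identity to the solver.
  ≤-by : ∀ {x y} z → 0# ≤ z → x + z ≈ y → x ≤ y
  ≤-by {x} z 0≤z x+z≈y = ≤-respʳ x+z≈y (≤-respˡ (+-identityʳ x) (+-monoʳ-≤ x 0≤z))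

  <-by : ∀ {x y} z → 0# < z → x + z ≈ y → x < y
  <-by z 0<z x+z≈y = <-respʳ x+z≈y (x<x+y 0<z)

  *-cancelʳ-≤ : ∀ {x y z} → 0# < z → x * z ≤ y * z → x ≤ y
  *-cancelʳ-≤ 0<z xz≤yz y<x = xz≤yz (*-monoˡ-< 0<z y<x)

  0<-cancelˡ : ∀ {x y} → 0# < x → 0# < x * y → 0# < y
  0<-cancelˡ {x} {y} 0<x 0<xy = *-cancelʳ-< 0<x (<-respˡ (sym (zeroˡ x)) (<-respʳ (*-comm x y) 0<xy))

  0≤-cancelˡ : ∀ {x y} → 0# < x → 0# ≤ x * y → 0# ≤ y
  0≤-cancelˡ {x} {y} 0<x 0≤xy y<0 = 0≤xy (<-respʳ (zeroʳ x) (*-monoʳ-< 0<x y<0))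

  -- If the product were negative, a positive `x` could be cancelled and would make `y` negative;
  -- hence `x` is 0, and so is the product.
  0≤* : ∀ {x y} → 0# ≤ x → 0# ≤ y → 0# ≤ x * y
  0≤* {x} {y} 0≤x 0≤y xy<0 = <-irrefl (<-respˡ (trans (*-congʳ (≤-antisym x≤0 0≤x)) (zeroˡ y)) xy<0)
    where
    x≤0 : x ≤ 0#
    x≤0 0<x = 0≤y (*-cancelʳ-< 0<x (<-respʳ (sym (zeroˡ x)) (<-respˡ (*-comm x y) xy<0)))

  *-monoʳ-≤ : ∀ {z x y} → 0# ≤ z → x ≤ y → z * x ≤ z * y
  *-monoʳ-≤ {z} {x} {y} 0≤z x≤y = ≤-by (z * (y - x)) (0≤* 0≤z (≤⇒0≤- x≤y))
    (solve 3 (λ x y z → z :* x :+ z :* (y :- x) := z :* y) refl x y z)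

  *-monoˡ-≤ : ∀ {z x y} → 0# ≤ z → x ≤ y → x * z ≤ y * z
  *-monoˡ-≤ {z} {x} {y} 0≤z x≤y = ≤-respˡ (*-comm z x) (≤-respʳ (*-comm z y) (*-monoʳ-≤ 0≤z x≤y))

  sq-mono-≤-< : ∀ {x y} → 0# ≤ x → x < y → x * x < y * y
  sq-mono-≤-< 0≤x x<y = ≤-<-trans (*-monoʳ-≤ 0≤x (<⇒≤ x<y)) (*-monoˡ-< (≤-<-trans 0≤x x<y) x<y)

  sq-cancel-≤ : ∀ {x y} → 0# ≤ y → x * x ≤ y * y → x ≤ y
  sq-cancel-≤ 0≤y x²≤y² y<x = x²≤y² (sq-mono-≤-< 0≤y y<x)

  -- Cotransitivity of 0 < 1 leaves only the case x < 1, in which x² ≤ x.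
  0<sq⇒0< : ∀ {x} → 0# ≤ x → 0# < x * x → 0# < x
  0<sq⇒0< {x} 0≤x 0<x² with <-cotrans 0<1 x
  ... | inj₁ 0<x = 0<x
  ... | inj₂ x<1 = <-≤-trans 0<x² (≤-respʳ (*-identityʳ x) (*-monoʳ-≤ 0≤x (<⇒≤ x<1)))

  *-cancelʳ-# : ∀ {x y z} → z # 0# → x * z ≈ y * z → x ≈ y
  *-cancelʳ-# {x} {y} {z} z#0 xz≈yz = trans (sym (undo x)) (trans (*-congʳ xz≈yz) (undo y))
    where
    z⁻¹ = 1# / z ⟨ z#0 ⟩
    undo : ∀ w → w * z * z⁻¹ ≈ w
    undo w = trans (*-assoc w z z⁻¹)
      (trans (*-congˡ (trans (*-comm z z⁻¹) (/-* 1# z _))) (*-identityʳ w))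

  0≤ι : ∀ n → 0# ≤ ι n
  0≤ι zero    = <-irrefl
  0≤ι (suc n) = <⇒≤ (0<ι (suc n))

-- Polynomials through their coefficients, and finite sums.

module Coefficients (R : RealNumbers) where
  open RealNumbers R hiding (zero)
  open Polynomials R
  open Naturals R
  open ℤSolver using (solve; _:=_; _:+_; _:*_; _:-_; :-_; con)

  infix 4 _≋_
  -- Lists that differ by trailing zeros are the same polynomial; evaluation and derivative respect
  -- this relation.
  _≋_ : Poly → Poly → Set
  p ≋ q = ∀ k → coeff p k ≈ coeff q k

  coeff-⊕ : ∀ p q k → coeff (p ⊕ q) k ≈ coeff p k + coeff q k
  coeff-⊕ []      q       k       = sym (+-identityˡ _)
  coeff-⊕ (a ∷ p) []      k       = sym (+-identityʳ _)
  coeff-⊕ (a ∷ p) (b ∷ q) zero    = refl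
  coeff-⊕ (a ∷ p) (b ∷ q) (suc k) = coeff-⊕ p q k

  coeff-· : ∀ c p k → coeff (c · p) k ≈ c * coeff p k
  coeff-· c []      k       = sym (zeroʳ c)
  coeff-· c (a ∷ p) zero    = refl
  coeff-· c (a ∷ p) (suc k) = coeff-· c p k

  coeff-0∷[] : ∀ k → coeff (0# ∷ []) k ≈ 0#
  coeff-0∷[] zero    = refl
  coeff-0∷[] (suc k) = refl

  shift : (ℕ → ℝ) → ℕ → ℝ
  shift f zero    = 0#
  shift f (suc k) = f k

  shift-cong : ∀ {f g} → (∀ k → f k ≈ g k) → ∀ k → shift f k ≈ shift g k
  shift-cong f≈g zero    = refl
  shift-cong f≈g (suc k) = f≈g k

  coeff-1⊗ : ∀ p k → coeff ((1# ∷ []) ⊗ p) k ≈ coeff p k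
  coeff-1⊗ p k = trans (coeff-⊕ (1# · p) (0# ∷ []) k)
    (trans (+-cong (trans (coeff-· 1# p k) (*-identityˡ _)) (coeff-0∷[] k)) (+-identityʳ _))

  coeff-ax⊗ : ∀ a p k → coeff ((0# ∷ a ∷ []) ⊗ p) k ≈ a * shift (coeff p) k
  coeff-ax⊗ a p zero = trans (coeff-⊕ (0# · p) _ zero)
    (trans (+-congʳ (trans (coeff-· 0# p zero) (zeroˡ _))) (trans (+-identityʳ _) (sym (zeroʳ a))))
  coeff-ax⊗ a p (suc k) = trans (coeff-⊕ (0# · p) _ (suc k))
    (trans (+-cong (trans (coeff-· 0# p (suc k)) (zeroˡ _))
      (trans (coeff-⊕ (a · p) (0# ∷ []) k) (+-cong (coeff-· a p k) (coeff-0∷[] k))))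
    (trans (+-identityˡ _) (+-identityʳ _)))

  coeff-′ : ∀ p k → coeff (p ′) k ≈ ι (suc k) * coeff p (suc k)
  coeff-′ []      k       = sym (zeroʳ _)
  coeff-′ (a ∷ p) zero    = trans (coeff-⊕ p (0# ∷ p ′) zero)
    (solve 1 (λ b → b :+ con (+ 0) := (con (+ 1) :+ con (+ 0)) :* b) refl _)
  coeff-′ (a ∷ p) (suc k) = trans (coeff-⊕ p (0# ∷ p ′) (suc k)) (trans (+-congˡ (coeff-′ p k))
    (solve 2 (λ b n → b :+ n :* b := (con (+ 1) :+ n) :* b) refl _ (ι (suc k))))

  ′-cong : ∀ {p q} → p ≋ q → p ′ ≋ q ′
  ′-cong {p} {q} p≋q k = trans (coeff-′ p k) (trans (*-congˡ (p≋q (suc k))) (sym (coeff-′ q k)))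

  ⟦⟧-cong : ∀ {p q} → p ≋ q → ∀ x → ⟦ p ⟧ x ≈ ⟦ q ⟧ x
  ⟦⟧-cong {[]}    {[]}    p≋q x = refl
  ⟦⟧-cong {[]}    {b ∷ q} p≋q x = trans (sym (trans (+-congˡ (zeroʳ x)) (+-identityʳ 0#)))
    (+-cong (p≋q zero) (*-congˡ (⟦⟧-cong {[]} {q} (λ k → p≋q (suc k)) x)))
  ⟦⟧-cong {a ∷ p} {[]}    p≋q x = trans
    (+-cong (p≋q zero) (*-congˡ (⟦⟧-cong {p} {[]} (λ k → p≋q (suc k)) x)))
    (trans (+-congˡ (zeroʳ x)) (+-identityʳ 0#))
  ⟦⟧-cong {a ∷ p} {b ∷ q} p≋q x =
    +-cong (p≋q zero) (*-congˡ (⟦⟧-cong {p} {q} (λ k → p≋q (suc k)) x))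

  ⟦⊕⟧ : ∀ p q x → ⟦ p ⊕ q ⟧ x ≈ ⟦ p ⟧ x + ⟦ q ⟧ x
  ⟦⊕⟧ []      q       x = sym (+-identityˡ _)
  ⟦⊕⟧ (a ∷ p) []      x = sym (+-identityʳ _)
  ⟦⊕⟧ (a ∷ p) (b ∷ q) x = trans (+-congˡ (*-congˡ (⟦⊕⟧ p q x)))
    (solve 5 (λ a b x p q → a :+ b :+ x :* (p :+ q) := a :+ x :* p :+ (b :+ x :* q)) refl a b x _ _)

  ⟦·⟧ : ∀ c p x → ⟦ c · p ⟧ x ≈ c * ⟦ p ⟧ x
  ⟦·⟧ c []      x = sym (zeroʳ c)
  ⟦·⟧ c (a ∷ p) x = trans (+-congˡ (*-congˡ (⟦·⟧ c p x)))
    (solve 4 (λ a c x p → c :* a :+ x :* (c :* p) := c :* (a :+ x :* p)) refl a c x _)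

  ⟦⊕′⟧ : ∀ p q x → ⟦ (p ⊕ q) ′ ⟧ x ≈ ⟦ p ′ ⟧ x + ⟦ q ′ ⟧ x
  ⟦⊕′⟧ p q x = trans (⟦⟧-cong {(p ⊕ q) ′} {p ′ ⊕ q ′} (λ k → trans (coeff-′ (p ⊕ q) k)
    (trans (*-congˡ (coeff-⊕ p q (suc k))) (trans (distribˡ _ _ _)
    (trans (sym (+-cong (coeff-′ p k) (coeff-′ q k))) (sym (coeff-⊕ (p ′) (q ′) k)))))) x)
    (⟦⊕⟧ (p ′) (q ′) x)

  ⟦·′⟧ : ∀ c p x → ⟦ (c · p) ′ ⟧ x ≈ c * ⟦ p ′ ⟧ x
  ⟦·′⟧ c p x = trans (⟦⟧-cong {(c · p) ′} {c · p ′} (λ k → trans (coeff-′ (c · p) k)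
    (trans (*-congˡ (coeff-· c p (suc k))) (trans (solve 3 (λ a b c → a :* (b :* c) := b :* (a :* c)) refl _ _ _)
    (trans (sym (*-congˡ (coeff-′ p k))) (sym (coeff-· c (p ′) k)))))) x)
    (⟦·⟧ c (p ′) x)

  ∑ : ℕ → (ℕ → ℝ) → ℝ
  ∑ zero    f = 0#
  ∑ (suc n) f = f 0 + ∑ n (λ i → f (suc i))

  ∑-cong : ∀ n {f g} → (∀ i → f i ≈ g i) → ∑ n f ≈ ∑ n g
  ∑-cong zero    f≈g = refl
  ∑-cong (suc n) f≈g = +-cong (f≈g 0) (∑-cong n (λ i → f≈g (suc i)))

  ∑-+ : ∀ n f g → ∑ n (λ i → f i + g i) ≈ ∑ n f + ∑ n g
  ∑-+ zero    f g = sym (+-identityʳ 0#)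
  ∑-+ (suc n) f g = trans (+-congˡ (∑-+ n _ _))
    (solve 4 (λ a b c d → a :+ b :+ (c :+ d) := a :+ c :+ (b :+ d)) refl _ _ _ _)

  ∑-* : ∀ n c f → ∑ n (λ i → c * f i) ≈ c * ∑ n f
  ∑-* zero    c f = sym (zeroʳ c)
  ∑-* (suc n) c f = trans (+-congˡ (∑-* n c _)) (sym (distribˡ _ _ _))

  ∑-zero : ∀ n {f} → (∀ i → f i ≈ 0#) → ∑ n f ≈ 0#
  ∑-zero zero    f≈0 = refl
  ∑-zero (suc n) f≈0 = trans (+-cong (f≈0 0) (∑-zero n (λ i → f≈0 (suc i)))) (+-identityʳ 0#)

  ∑-shift : ∀ n (b : ℕ → ℝ) (f : ℕ → ℕ → ℝ) k →
    ∑ n (λ i → b i * shift (f i) k) ≈ shift (λ j → ∑ n (λ i → b i * f i j)) k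
  ∑-shift n b f zero    = ∑-zero n (λ i → zeroʳ _)
  ∑-shift n b f (suc k) = refl

  coeff-foldr : ∀ (F : ℕ → Poly) f n k →
    coeff (foldr _⊕_ [] (map F (applyUpTo f n))) k ≈ ∑ n (λ i → coeff (F (f i)) k)
  coeff-foldr F f zero    k = refl
  coeff-foldr F f (suc n) k = trans (coeff-⊕ (F (f 0)) _ k) (+-congˡ (coeff-foldr F (λ i → f (suc i)) n k))

-- From the generating function to a recurrence in degree and parameter.

module Recurrence (R : RealNumbers) where
  open RealNumbers R hiding (zero)
  open OrderedFieldProperties R
  open Polynomials R
  open Gegenbauer R
  open Naturals R
  open OrderedField R
  open Coefficients R
  open ℤSolver using (solve; _:=_; _:+_; _:*_; _:-_; :-_; con)

  -- G l (suc m) is the Gegenbauer polynomial of degree m and parameter l; the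
  -- recurrence says (1 - 2xt + t²)^-l = (1 - 2xt + t²) · (1 - 2xt + t²)^-(l+1).
  G : ℕ → ℕ → Poly
  G l       zero          = []
  G l       (suc zero)    = 1# ∷ []
  G zero    (suc (suc m)) = []
  G (suc l) (suc (suc m)) =
    (0# ∷ ι 2 · G (suc l) (suc m)) ⊕ ((- 1#) · G (suc l) m ⊕ G l (suc (suc m)))

  coeff-G : ∀ l m k → coeff (G (suc l) (suc (suc m))) k
    ≈ ι 2 * shift (coeff (G (suc l) (suc m))) k + (- 1# * coeff (G (suc l) m) k + coeff (G l (suc (suc m))) k)
  coeff-G l m k = trans (coeff-⊕ (0# ∷ ι 2 · G (suc l) (suc m)) ((- 1#) · G (suc l) m ⊕ G l (suc (suc m))) k)
    (+-cong (lemma k) (trans (coeff-⊕ ((- 1#) · G (suc l) m) (G l (suc (suc m))) k) (+-congʳ (coeff-· (- 1#) (G (suc l) m) k))))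
    where
    lemma : ∀ k → coeff (0# ∷ ι 2 · G (suc l) (suc m)) k ≈ ι 2 * shift (coeff (G (suc l) (suc m))) k
    lemma zero    = sym (zeroʳ _)
    lemma (suc k) = coeff-· (ι 2) (G (suc l) (suc m)) k

  binomial-step : ∀ α k → ι (suc k) * binomial α (suc k) ≈ binomial α k * (α - ι k)
  binomial-step α k = trans (*-comm _ _) (/-* _ _ _)

  *-cancelˡ-ι : ∀ k {x y} → ι (suc k) * x ≈ ι (suc k) * y → x ≈ y
  *-cancelˡ-ι k {x} {y} eq = *-cancelʳ-# (ι#0 (suc k)) (trans (*-comm x _) (trans eq (*-comm _ y)))

  module _ {α β : ℝ} (β≈α+1 : β ≈ α + 1#) where

    -- By induction: since β - (k + 1) ≈ α - k, both sides acquire the same factor. It expresses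
    -- `binomial β` through `binomial α`, from which Pascal's rule follows for real exponents.
    binomial-absorption : ∀ k → ι (suc k) * binomial β (suc k) ≈ β * binomial α k
    binomial-absorption zero = trans (binomial-step β 0)
      (solve 1 (λ b → con (+ 1) :* (b :- con (+ 0)) := b :* con (+ 1)) refl β)
    binomial-absorption (suc k) = trans (binomial-step β (suc k)) (*-cancelˡ-ι k
      (trans (solve 3 (λ n b c → n :* (b :* c) := n :* b :* c) refl _ _ _)
      (trans (*-cong (binomial-absorption k) (trans (+-congʳ β≈α+1)
        (solve 2 (λ a n → a :+ con (+ 1) :- (con (+ 1) :+ n) := a :- n) refl α (ι k))))
      (trans (*-assoc _ _ _) (trans (*-congˡ (sym (binomial-step α k)))
      (solve 3 (λ n b c → b :* (n :* c) := n :* (b :* c)) refl _ _ _))))))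

    binomial-pascal : ∀ k → binomial β (suc k) ≈ binomial α (suc k) + binomial α k
    binomial-pascal k = *-cancelˡ-ι k (trans (binomial-absorption k) (trans (*-congʳ β≈α+1)
      (trans (solve 3 (λ a b n → (a :+ con (+ 1)) :* b := b :* (a :- n) :+ (con (+ 1) :+ n) :* b) refl α (binomial α k) (ι k))
      (trans (+-congʳ (sym (binomial-step α k))) (sym (distribˡ _ _ _))))))

  binomial-0 : ∀ k → binomial (- ι 0) (suc k) ≈ 0#
  binomial-0 zero = *-cancelˡ-ι 0 (trans (binomial-step (- ι 0) 0)
    (solve 0 (con (+ 1) :* (:- con (+ 0) :- con (+ 0)) := (con (+ 1) :+ con (+ 0)) :* con (+ 0)) refl))
  binomial-0 (suc k) = *-cancelˡ-ι (suc k) (trans (binomial-step (- ι 0) (suc k))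
    (trans (*-congʳ (binomial-0 k)) (trans (zeroˡ _) (sym (zeroʳ _)))))

  -- The coefficient of x^j t^(m-1) in (t² - 2xt)^k.
  U : ℕ → ℕ → ℕ → ℝ
  U k zero    j = 0#
  U k (suc m) j = coeff (power -2xt+t² k m) j

  -- Only the coefficients of t and t² survive in the convolution. The index of `U` is one ahead of
  -- the power of t, so that `U k zero` supplies the 0 where t² would reach below t⁰.
  U-step : ∀ k m j → U (suc k) (suc (suc m)) j ≈ - ι 2 * shift (U k (suc m)) j + U k m j
  U-step k zero    j = trans (coeff-⊕ ((0# ∷ - ι 2 ∷ []) ⊗ power -2xt+t² k 0) [] j)
    (+-congʳ (coeff-ax⊗ (- ι 2) (power -2xt+t² k 0) j))
  U-step k (suc m) j = trans (coeff-foldr (λ i → -2xt+t² i ⊗ power -2xt+t² k (suc (suc m) ∸ i)) (λ i → i) (suc (suc (suc m))) j)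
    (trans (+-identityˡ _)
    (+-cong (coeff-ax⊗ (- ι 2) (power -2xt+t² k (suc m)) j)
    (trans (+-cong (coeff-1⊗ (power -2xt+t² k m) j) (∑-zero m (λ i → refl))) (+-identityʳ _))))

  [1+u]^-coeff : ℝ → ℕ → ℕ → ℕ → ℝ
  [1+u]^-coeff α K m j = ∑ K (λ k → binomial α k * U k m j)

  gegenbauer-coeff : ∀ a m j → coeff (gegenbauer a m) j ≈ [1+u]^-coeff (- a) (suc m) (suc m) j
  gegenbauer-coeff a m j = trans (coeff-foldr (λ k → binomial (- a) k · power -2xt+t² k m) (λ i → i) (suc m) j)
    (∑-cong (suc m) (λ k → coeff-· (binomial (- a) k) (power -2xt+t² k m) j))

  -- This is (1 + u)^(α + 1) = (1 + u)^α + u (1 + u)^α, by Pascal's rule; taking out a factor u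
  -- shortens the sum over k from K + 1 terms to K.
  [1+u]^-step : ∀ {α β} → β ≈ α + 1# → ∀ K m j →
    [1+u]^-coeff β (suc K) (suc (suc m)) j
      ≈ [1+u]^-coeff α (suc K) (suc (suc m)) j
        + (- ι 2 * shift ([1+u]^-coeff α K (suc m)) j + [1+u]^-coeff α K m j)
  [1+u]^-step {α} {β} β≈α+1 K m j =
    trans (+-congˡ (trans (∑-cong K (λ k → trans (*-congʳ (binomial-pascal β≈α+1 k)) (distribʳ _ _ _)))
      (∑-+ K (λ k → binomial α (suc k) * U (suc k) (suc (suc m)) j) (λ k → binomial α k * U (suc k) (suc (suc m)) j))))
    (trans (sym (+-assoc _ _ _)) (+-congˡ
    (trans (∑-cong K (λ k → trans (*-congˡ (U-step k m j))
      (solve 4 (λ b c s v → b :* (c :* s :+ v) := c :* (b :* s) :+ b :* v) refl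
        (binomial α k) (- ι 2) (shift (U k (suc m)) j) (U k m j))))
    (trans (∑-+ K (λ k → - ι 2 * (binomial α k * shift (U k (suc m)) j)) (λ k → binomial α k * U k m j)) (+-congʳ
    (trans (∑-* K (- ι 2) (λ k → binomial α k * shift (U k (suc m)) j)) (*-congˡ (∑-shift K (binomial α) (λ k → U k (suc m)) j))))))))

  -- The truncation `K` has to vary because the recursion shortens the sums. The inductive step is
  -- `[1+u]^-step` from exponent -(l + 1) to -l, solved for the former.
  [1+u]^-G : ∀ l m K → m ℕ.≤ K → ∀ j → [1+u]^-coeff (- ι l) K m j ≈ coeff (G l m) j
  [1+u]^-G l zero K m≤K j = ∑-zero K (λ k → zeroʳ _)
  [1+u]^-G l (suc zero) (suc K) m≤K j = trans (+-cong (*-identityˡ _) (∑-zero K (λ k → zeroʳ _))) (+-identityʳ _)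
  [1+u]^-G zero (suc (suc m)) (suc K) m≤K j = trans (+-cong (zeroʳ _)
    (∑-zero K (λ k → trans (*-congʳ (binomial-0 k)) (zeroˡ _)))) (+-identityʳ _)
  [1+u]^-G (suc l) (suc (suc m)) (suc K) (s≤s m<K) j = trans
    (trans (solve 4 (λ c t s v → c := (c :+ (:- t :* s :+ v)) :+ (t :* s :- v)) refl
      ([1+u]^-coeff (- ι (suc l)) (suc K) (suc (suc m)) j) (ι 2)
      (shift ([1+u]^-coeff (- ι (suc l)) K (suc m)) j) ([1+u]^-coeff (- ι (suc l)) K m j))
    (trans (+-cong (sym ([1+u]^-step -l≈ K m j))
      (+-cong (*-congˡ (shift-cong ([1+u]^-G (suc l) (suc m) K m<K) j)) (-‿cong ([1+u]^-G (suc l) m K (ℕ.≤-trans (ℕ.n≤1+n m) m<K) j))))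
    (trans (+-congʳ ([1+u]^-G l (suc (suc m)) (suc K) (s≤s m<K) j))
    (solve 4 (λ g t s v → g :+ (t :* s :- v) := t :* s :+ (:- con (+ 1) :* v :+ g)) refl _ _ _ _))))
    (sym (coeff-G l m j))
    where
    -l≈ : - ι l ≈ - ι (suc l) + 1#
    -l≈ = solve 1 (λ l → :- l := :- (con (+ 1) :+ l) :+ con (+ 1)) refl (ι l)

  gegenbauer≋G : ∀ l m → gegenbauer (ι l) m ≋ G l (suc m)
  gegenbauer≋G l m j = trans (gegenbauer-coeff (ι l) m j) ([1+u]^-G l (suc m) (suc m) ℕ.≤-refl j)

-- Classical identities between values of Gegenbauer polynomials.

module Values (R : RealNumbers) where
  open RealNumbers R hiding (zero)
  open Polynomials R
  open Naturals R
  open Coefficients R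
  open Recurrence R
  open ℤSolver using (solve; _:=_; _:+_; _:*_; _:-_; :-_; con)

  g : ℝ → ℕ → ℕ → ℝ
  g x l       zero          = 0#
  g x l       (suc zero)    = 1#
  g x zero    (suc (suc m)) = 0#
  g x (suc l) (suc (suc m)) = ι 2 * x * g x (suc l) (suc m) - g x (suc l) m + g x l (suc (suc m))

  ⟦G⟧ : ∀ x l m → ⟦ G l m ⟧ x ≈ g x l m
  ⟦G⟧ x l       zero          = refl
  ⟦G⟧ x l       (suc zero)    = trans (+-congˡ (zeroʳ x)) (+-identityʳ 1#)
  ⟦G⟧ x zero    (suc (suc m)) = refl
  ⟦G⟧ x (suc l) (suc (suc m)) =
    trans (⟦⊕⟧ (0# ∷ ι 2 · G (suc l) (suc m)) ((- 1#) · G (suc l) m ⊕ G l (suc (suc m))) x)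
    (trans (+-cong (+-congˡ (*-congˡ (trans (⟦·⟧ (ι 2) (G (suc l) (suc m)) x) (*-congˡ (⟦G⟧ x (suc l) (suc m))))))
      (trans (⟦⊕⟧ ((- 1#) · G (suc l) m) (G l (suc (suc m))) x)
        (+-cong (trans (⟦·⟧ (- 1#) (G (suc l) m) x) (*-congˡ (⟦G⟧ x (suc l) m))) (⟦G⟧ x l (suc (suc m))))))
    (solve 5 (λ x t a b c → con (+ 0) :+ x :* (t :* a) :+ (:- con (+ 1) :* b :+ c) := t :* x :* a :- b :+ c)
      refl x (ι 2) _ _ _))

  -- The coefficient form of d/dx (1 - 2xt + t²)^-l = 2lt (1 - 2xt + t²)^-(l+1), obtained by
  -- differentiating the recurrence.
  ⟦G′⟧ : ∀ x l m → ⟦ G l (suc m) ′ ⟧ x ≈ ι 2 * ι l * g x (suc l) m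
  ⟦G′⟧ x l       zero          = solve 2 (λ x l → con (+ 0) :+ x :* con (+ 0) := l :* con (+ 0)) refl x (ι 2 * ι l)
  ⟦G′⟧ x zero    (suc m)       = sym (trans (*-congʳ (zeroʳ _)) (zeroˡ _))
  ⟦G′⟧ x (suc l) (suc m) =
    trans (⟦⊕′⟧ (0# ∷ ι 2 · G (suc l) (suc m)) ((- 1#) · G (suc l) m ⊕ G l (suc (suc m))) x)
    (trans (+-cong
      (trans (⟦⊕⟧ (ι 2 · G (suc l) (suc m)) (0# ∷ (ι 2 · G (suc l) (suc m)) ′) x)
        (+-cong (trans (⟦·⟧ (ι 2) (G (suc l) (suc m)) x) (*-congˡ (⟦G⟧ x (suc l) (suc m))))
          (+-congˡ (*-congˡ (trans (⟦·′⟧ (ι 2) (G (suc l) (suc m)) x) (*-congˡ (⟦G′⟧ x (suc l) m)))))))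
      (trans (⟦⊕′⟧ ((- 1#) · G (suc l) m) (G l (suc (suc m))) x)
        (+-cong (trans (⟦·′⟧ (- 1#) (G (suc l) m) x) (*-congˡ (lemma m))) (⟦G′⟧ x l (suc m)))))
    (step m))
    where
    -- g x (suc (suc l)) (m - 1)
    prev : ℕ → ℝ
    prev zero    = 0#
    prev (suc m) = g x (suc (suc l)) m
    lemma : ∀ m → ⟦ G (suc l) m ′ ⟧ x ≈ ι 2 * ι (suc l) * prev m
    lemma zero    = sym (zeroʳ _)
    lemma (suc m) = ⟦G′⟧ x (suc l) m
    step : ∀ m → ι 2 * g x (suc l) (suc m) + (0# + x * (ι 2 * (ι 2 * ι (suc l) * g x (suc (suc l)) m)))
        + (- 1# * (ι 2 * ι (suc l) * prev m) + ι 2 * ι l * g x (suc l) (suc m))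
        ≈ ι 2 * ι (suc l) * g x (suc (suc l)) (suc m)
    step zero = solve 2 (λ x l → con (+ 2) :* con (+ 1) :+ (con (+ 0) :+ x :* (con (+ 2) :* (con (+ 2) :* (con (+ 1) :+ l) :* con (+ 0))))
        :+ (:- con (+ 1) :* (con (+ 2) :* (con (+ 1) :+ l) :* con (+ 0)) :+ con (+ 2) :* l :* con (+ 1))
        := con (+ 2) :* (con (+ 1) :+ l) :* con (+ 1)) refl x (ι l)
    step (suc m) = solve 5 (λ x l a b c → con (+ 2) :* a :+ (con (+ 0) :+ x :* (con (+ 2) :* (con (+ 2) :* (con (+ 1) :+ l) :* b)))
        :+ (:- con (+ 1) :* (con (+ 2) :* (con (+ 1) :+ l) :* c) :+ con (+ 2) :* l :* a)
        := con (+ 2) :* (con (+ 1) :+ l) :* (con (+ 2) :* x :* b :- c :+ a)) refl x (ι l) _ _ _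

  -- (1 - 2xt + t²) · d/dt (1 - 2xt + t²)^-l = 2l (x - t) (1 - 2xt + t²)^-l, divided by 1 - 2xt + t².
  degree-lowering : ∀ x l m → ι (suc m) * g x l (suc (suc m)) ≈ ι 2 * ι l * (x * g x (suc l) (suc m) - g x (suc l) m)
  degree-lowering x zero    m = solve 2 (λ m a → m :* con (+ 0) := con (+ 2) :* con (+ 0) :* a) refl (ι (suc m)) _
  degree-lowering x (suc l) zero = trans
    (solve 3 (λ x a b → (con (+ 1) :+ con (+ 0)) :* (con (+ 2) :* x :* con (+ 1) :- con (+ 0) :+ b)
      := con (+ 2) :* x :+ ((con (+ 1) :+ con (+ 0)) :* b)) refl x 0# (g x l 2))
    (trans (+-congˡ (degree-lowering x l 0))
    (solve 2 (λ x l → con (+ 2) :* x :+ con (+ 2) :* l :* (x :* con (+ 1) :- con (+ 0))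
      := con (+ 2) :* (con (+ 1) :+ l) :* (x :* con (+ 1) :- con (+ 0))) refl x (ι l)))
  degree-lowering x (suc l) (suc zero) = trans
    (solve 3 (λ x a b → con (+ 2) :* (con (+ 2) :* x :* a :- con (+ 1) :+ b)
      := con (+ 2) :* x :* ((con (+ 1) :+ con (+ 0)) :* a) :+ con (+ 2) :* x :* a :- con (+ 2) :+ con (+ 2) :* b)
      refl x (g x (suc l) 2) (g x l 3))
    (trans (+-cong (+-congʳ (+-congʳ (*-congˡ (degree-lowering x (suc l) 0)))) (degree-lowering x l 1))
    (solve 3 (λ x l a → con (+ 2) :* x :* (con (+ 2) :* (con (+ 1) :+ l) :* (x :* con (+ 1) :- con (+ 0)))
      :+ con (+ 2) :* x :* a :- con (+ 2) :+ con (+ 2) :* l :* (x :* a :- con (+ 1))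
      := con (+ 2) :* (con (+ 1) :+ l) :* (x :* (con (+ 2) :* x :* con (+ 1) :- con (+ 0) :+ a) :- con (+ 1)))
      refl x (ι l) (g x (suc l) 2)))
  degree-lowering x (suc l) (suc (suc m)) = trans
    (solve 5 (λ x m a b c → (con (+ 1) :+ (con (+ 1) :+ m)) :* (con (+ 2) :* x :* a :- b :+ c)
      := con (+ 2) :* x :* ((con (+ 1) :+ m) :* a) :- m :* b :+ (con (+ 2) :* x :* a :- con (+ 2) :* b)
        :+ (con (+ 1) :+ (con (+ 1) :+ m)) :* c)
      refl x (ι (suc m)) (g x (suc l) (suc (suc (suc m)))) (g x (suc l) (suc (suc m))) _)
    (trans (+-cong (+-congʳ (+-cong (*-congˡ (degree-lowering x (suc l) (suc m))) (-‿cong (degree-lowering x (suc l) m))))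
      (degree-lowering x l (suc (suc m))))
    (solve 7 (λ x l a b p q r → con (+ 2) :* x :* (con (+ 2) :* (con (+ 1) :+ l) :* (x :* p :- q))
        :- con (+ 2) :* (con (+ 1) :+ l) :* (x :* q :- r)
        :+ (con (+ 2) :* x :* a :- con (+ 2) :* b) :+ con (+ 2) :* l :* (x :* a :- b)
      := con (+ 2) :* (con (+ 1) :+ l) :* (x :* (con (+ 2) :* x :* p :- q :+ a) :- (con (+ 2) :* x :* q :- r :+ b)))
      refl x (ι l) _ _ (g x (suc (suc l)) (suc (suc m))) (g x (suc (suc l)) (suc m)) (g x (suc (suc l)) m)))

  -- The term with the smaller parameter in the recurrence of `g` is eliminated by
  -- `degree-lowering`; what remains involves a single parameter.
  three-term : ∀ x l m → ι (suc m) * g x (suc l) (suc (suc m))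
    ≈ ι 2 * x * (ι (suc m) + ι l) * g x (suc l) (suc m) - (ι (suc m) + ι 2 * ι l) * g x (suc l) m
  three-term x l m = trans (solve 4 (λ n b c d → n :* (b :- c :+ d) := n :* (b :- c) :+ n :* d) refl _ _ _ _)
    (trans (+-congˡ (degree-lowering x l m))
    (solve 5 (λ x n l b c → n :* (con (+ 2) :* x :* b :- c) :+ con (+ 2) :* l :* (x :* b :- c)
      := con (+ 2) :* x :* (n :+ l) :* b :- (n :+ con (+ 2) :* l) :* c) refl x (ι (suc m)) (ι l) _ _))

  -- (x² - 1) C_m′ = m x C_m - (m + 2l + 1) C_{m-1} for the parameter l + 1.
  derivative-relation : ∀ x l m → (x * x - 1#) * (ι 2 * ι (suc l) * g x (suc (suc l)) m)
    ≈ ι m * x * g x (suc l) (suc m) - (ι m + ι 2 * ι l + 1#) * g x (suc l) m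
  derivative-relation x l zero = solve 4 (λ y n z k → y :* (n :* con (+ 0)) := con (+ 0) :* z :* con (+ 1) :- k :* con (+ 0)) refl
    (x * x - 1#) (ι 2 * ι (suc l)) x (ι 0 + ι 2 * ι l + 1#)
  derivative-relation x l (suc zero) = trans
     (solve 2 (λ x l → (x :* x :- con (+ 1)) :* (con (+ 2) :* (con (+ 1) :+ l) :* con (+ 1))
       := x :* (con (+ 2) :* (con (+ 1) :+ l) :* (x :* con (+ 1) :- con (+ 0)))
         :- (con (+ 1) :+ con (+ 0) :+ con (+ 2) :* l :+ con (+ 1)) :* con (+ 1)) refl x (ι l))
     (+-congʳ (trans (*-congˡ (sym (degree-lowering x (suc l) 0)))
       (solve 3 (λ x n g → x :* (n :* g) := n :* x :* g) refl x (ι 1) _)))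
  -- The identity is arranged so that the first summand is `degree-lowering` and the last bracket
  -- vanishes by `three-term`.
  derivative-relation x l (suc (suc m)) = trans
    (solve 6 (λ x l n a b e → let c = con (+ 2) :* x :* a :- b :+ e; k = con (+ 1) :+ l in
        (x :* x :- con (+ 1)) :* (con (+ 2) :* k :* c)
        := x :* (con (+ 2) :* k :* (x :* c :- a)) :- (con (+ 1) :+ n :+ con (+ 2) :* l :+ con (+ 1)) :* e
           :+ (n :* c :- (con (+ 2) :* x :* (n :+ k) :* a :- (n :+ con (+ 2) :* k) :* b)))
      refl x (ι l) (ι (suc m)) (g x (suc (suc l)) (suc m)) (g x (suc (suc l)) m) (g x (suc l) (suc (suc m))))
    (trans (+-cong
      (+-congʳ (trans (*-congˡ (sym (degree-lowering x (suc l) (suc m))))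
        (solve 3 (λ x n g → x :* (n :* g) := n :* x :* g) refl x _ _)))
      (trans (+-congʳ (three-term x (suc l) m)) (-‿inverseʳ _)))
    (+-identityʳ _))

  -- With C′ and C″ written as Gegenbauer polynomials of larger parameter: `degree-lowering`
  -- expresses C by two of parameter l + 2, and `derivative-relation` trades the lower one for a
  -- derivative.
  gegenbauer-ode : ∀ x l m → ι (suc m) * (ι (suc m) + ι 2 * ι (suc l)) * g x (suc l) (suc (suc m))
    ≈ ι 2 * ι (suc l) * ((ι 2 * ι (suc l) + 1#) * x * g x (suc (suc l)) (suc m)
        + (x * x - 1#) * (ι 2 * ι (suc (suc l)) * g x (suc (suc (suc l))) m))
  gegenbauer-ode x l m = trans
    (trans (solve 3 (λ n s c → n :* s :* c := s :* (n :* c)) refl (ι (suc m)) (ι (suc m) + ι 2 * ι (suc l)) _)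
    (trans (*-congˡ (degree-lowering x (suc l) m))
    (solve 5 (λ x l m b e → let k = con (+ 1) :+ l in
      (con (+ 1) :+ m :+ con (+ 2) :* k) :* (con (+ 2) :* k :* (x :* b :- e))
      := con (+ 2) :* k :* ((con (+ 2) :* k :+ con (+ 1)) :* x :* b :+ (m :* x :* b :- (m :+ con (+ 2) :* k :+ con (+ 1)) :* e)))
      refl x (ι l) (ι m) _ _)))
    (sym (*-congˡ (+-congˡ (derivative-relation x (suc l) m))))

-- Positivity and the logarithmic derivative to the right of γ.

module CauchyTransformBound (R : RealNumbers) where
  open RealNumbers R hiding (zero)
  open OrderedFieldProperties R
  open SquareRoot R
  open Naturals R
  open OrderedField R
  open Values R
  open ℤSolver using (solve; _:=_; _:+_; _:*_; _:-_; :-_; con)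

  module _ {x : ℝ} (1≤x : 1# ≤ x) where

    0≤g : ∀ l m → 0# ≤ g x l m
    -- The recurrence subtracts the value two degrees lower, so nonnegativity alone does not
    -- propagate; monotonicity in the degree is carried along.
    0≤g-step : ∀ l m → 0# ≤ g x (suc l) m × 0# ≤ g x (suc l) (suc m) - g x (suc l) m

    0≤g zero    zero          = <-irrefl
    0≤g zero    (suc zero)    = <⇒≤ 0<1
    0≤g zero    (suc (suc m)) = <-irrefl
    0≤g (suc l) m             = proj₁ (0≤g-step l m)

    0≤g-step l zero    = <-irrefl , ≤-respʳ (solve 0 (con (+ 1) := con (+ 1) :- con (+ 0)) refl) (<⇒≤ 0<1)
    0≤g-step l (suc m) with 0≤g-step l m
    ... | 0≤a , 0≤b-a = 0≤b , ≤-respʳ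
      (solve 4 (λ x a b c → b :- a :+ con (+ 2) :* ((x :- con (+ 1)) :* b) :+ c := con (+ 2) :* x :* b :- a :+ c :- b)
        refl x (g x (suc l) m) (g x (suc l) (suc m)) (g x l (suc (suc m))))
      (0≤+ (0≤+ 0≤b-a (0≤* (0≤ι 2) (0≤* (≤⇒0≤- 1≤x) 0≤b))) (0≤g l (suc (suc m))))
      where
      0≤b : 0# ≤ g x (suc l) (suc m)
      0≤b = ≤-respʳ (solve 2 (λ a b → a :+ (b :- a) := b) refl _ _) (0≤+ 0≤a 0≤b-a)

  -- For n > 0 and x > 1 its sign amounts to the Laguerre inequality (m + 1) C C″ ≤ m C′²
  -- for the Gegenbauer polynomial C of degree m + 1 and parameter n.
  turán : ℝ → ℕ → ℕ → ℝ
  turán x n m = (ι 2 * (ι m + ι n) + 1#) * x * C * E - ι m * C * C - (ι m + ι 2 * ι n + 1#) * E * E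
    where
    C = g x (suc n) (suc m)
    E = g x (suc n) m

  -- Eliminating the highest degree by `three-term` reproduces the previous quadratic form, up to a
  -- multiple of (x² - 1) times a square.
  turán-step : ∀ x n m → ι (suc m) * turán x n (suc m)
    ≈ (ι (suc m) + ι 2 * ι n) * turán x n m
      + ι 2 * (ι (suc m) + ι n) * ((x * x - 1#) * (g x (suc n) (suc m) * g x (suc n) (suc m)))
  turán-step x n m = trans
    (solve 5 (λ x n k c e → k :* ((con (+ 2) :* (k :+ n) :+ con (+ 1)) :* x :* c :* e :- k :* c :* c :- (k :+ con (+ 2) :* n :+ con (+ 1)) :* e :* e)
      := (k :* c) :* ((con (+ 2) :* (k :+ n) :+ con (+ 1)) :* x :* e :- k :* c) :- k :* (k :+ con (+ 2) :* n :+ con (+ 1)) :* e :* e)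
      refl x (ι n) (ι (suc m)) (g x (suc n) (suc (suc m))) (g x (suc n) (suc m)))
    (trans (+-congʳ (*-cong (three-term x n m) (+-congˡ (-‿cong (three-term x n m)))))
    (solve 5 (λ x n m e f → let k = con (+ 1) :+ m; kc = con (+ 2) :* x :* (k :+ n) :* e :- (k :+ con (+ 2) :* n) :* f in
       kc :* ((con (+ 2) :* (k :+ n) :+ con (+ 1)) :* x :* e :- kc) :- k :* (k :+ con (+ 2) :* n :+ con (+ 1)) :* e :* e
       := (k :+ con (+ 2) :* n) :* ((con (+ 2) :* (m :+ n) :+ con (+ 1)) :* x :* e :* f :- m :* e :* e :- (m :+ con (+ 2) :* n :+ con (+ 1)) :* f :* f)
          :+ con (+ 2) :* (k :+ n) :* ((x :* x :- con (+ 1)) :* (e :* e)))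
      refl x (ι n) (ι m) (g x (suc n) (suc m)) (g x (suc n) m)))

  0≤x²-1 : ∀ {x} → 1# ≤ x → 0# ≤ x * x - 1#
  0≤x²-1 {x} 1≤x = ≤-respʳ (solve 1 (λ x → (x :- con (+ 1)) :* (x :- con (+ 1) :+ (con (+ 1) :+ con (+ 1))) := x :* x :- con (+ 1)) refl x)
    (0≤* (≤⇒0≤- 1≤x) (0≤+ (≤⇒0≤- 1≤x) (<⇒≤ 0<2)))

  0≤turán : ∀ {x} → 1# ≤ x → ∀ n m → 0# ≤ turán x n m
  0≤turán {x} 1≤x n zero = ≤-reflexive (solve 3 (λ x a b → con (+ 0) := a :* x :* con (+ 1) :* con (+ 0) :- con (+ 0) :* con (+ 1) :* con (+ 1) :- b :* con (+ 0) :* con (+ 0))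
    refl x _ _)
  0≤turán {x} 1≤x n (suc m) = 0≤-cancelˡ (0<ι (suc m)) (≤-respʳ (sym (turán-step x n m))
    (0≤+ (0≤* (0≤+ (0≤ι (suc m)) (0≤* (0≤ι 2) (0≤ι n))) (0≤turán 1≤x n m))
         (0≤* (0≤* (0≤ι 2) (0≤+ (0≤ι (suc m)) (0≤ι n))) (0≤* (0≤x²-1 1≤x) (0≤* 0≤E 0≤E)))))
    where 0≤E = 0≤g 1≤x (suc n) (suc m)

  -- C′(x) (n x + S) ≤ d (d + 2n) C(x) for the Gegenbauer polynomial C of degree d and parameter n + 1.
  Bound : ℝ → ℝ → ℕ → ℕ → Set
  Bound x S n d = ι 2 * ι (suc n) * g x (suc (suc n)) d * (ι n * x + S)
    ≤ ι d * (ι d + ι 2 * ι n) * g x (suc n) (suc d)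

  -- It suffices that (x² - 1) C′ + n x C ≤ S C: multiply by n x + S and use S² - n² x² = d (d + 2n)
  -- (x² - 1).
  bound-1<x : ∀ {x S} → 1# < x → 0# ≤ S → ∀ n m → let N = ι n + ι (suc m) in
    S * S ≈ N * N * (x * x - 1#) + ι n * ι n → Bound x S n (suc m)
  bound-1<x {x} {S} 1<x 0≤S n m S² = *-cancelʳ-≤ 0<y
    (≤-respˡ (trans (*-congʳ yC′≈) (solve 3 (λ y c z → y :* c :* z := c :* z :* y) refl y C′ (n′ * x + S)))
    (≤-respʳ rhs (*-monoˡ-≤ 0≤nx+S (≤-by (S * C - (yC′ + n′ * x * C)) (≤⇒0≤- key)
      (solve 3 (λ v w c → v :+ (c :- (v :+ w)) := c :- w) refl yC′ (n′ * x * C) (S * C))))))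
    where
    1≤x = <⇒≤ 1<x
    n′ = ι n
    d  = ι (suc m)
    y  = x * x - 1#
    C  = g x (suc n) (suc (suc m))
    E  = g x (suc n) (suc m)
    F  = g x (suc n) m
    C′ = ι 2 * ι (suc n) * g x (suc (suc n)) (suc m)
    E′ = ι 2 * ι (suc n) * g x (suc (suc n)) m
    yC′ = d * x * C - (d + ι 2 * n′ + 1#) * E
    0≤x : 0# ≤ x
    0≤x = <⇒≤ (<-trans 0<1 1<x)
    0<y : 0# < y
    0<y = <-respʳ (+-congʳ refl) (<⇒0<- (<-respˡ (*-identityʳ 1#) (sq-mono-< 0<1 1<x)))
    0≤C = 0≤g 1≤x (suc n) (suc (suc m))
    0≤nx+S : 0# ≤ n′ * x + S
    0≤nx+S = 0≤+ (0≤* (0≤ι n) 0≤x) 0≤S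
    yC′≈ : yC′ ≈ y * C′
    yC′≈ = sym (derivative-relation x n (suc m))
    yE′≈ : y * E′ ≈ d * C - (d + ι 2 * n′ + 1#) * x * E
    yE′≈ = trans (derivative-relation x n m) (trans
      (solve 5 (λ x n m e f → let d = con (+ 1) :+ m in
        m :* x :* e :- (m :+ con (+ 2) :* n :+ con (+ 1)) :* f
        := (con (+ 2) :* x :* (d :+ n) :* e :- (d :+ con (+ 2) :* n) :* f) :- (d :+ con (+ 2) :* n :+ con (+ 1)) :* x :* e)
        refl x n′ (ι m) E F)
      (+-congʳ (sym (three-term x n m))))
    key : yC′ + n′ * x * C ≤ S * C
    -- The difference of the squares is a multiple of the Turán form plus C (x² - 1) E′, both
    -- nonnegative beyond 1.
    key = sq-cancel-≤ (0≤* 0≤S 0≤C) (≤-by ((d + ι 2 * n′ + 1#) * turán x n (suc m) + C * (y * E′))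
      (0≤+ (0≤* (0≤+ (0≤+ (0≤ι (suc m)) (0≤* (0≤ι 2) (0≤ι n))) (<⇒≤ 0<1)) (0≤turán 1≤x n (suc m)))
           (0≤* 0≤C (0≤* (<⇒≤ 0<y) (0≤* (0≤* (0≤ι 2) (0≤ι (suc n))) (0≤g 1≤x (suc (suc n)) m)))))
      (trans (+-congˡ (+-congˡ (*-congˡ yE′≈)))
      (trans (solve 5 (λ x n d c e → let k = d :+ con (+ 2) :* n :+ con (+ 1); v = d :* x :* c :- k :* e :+ n :* x :* c in
        v :* v :+ (k :* ((con (+ 2) :* (d :+ n) :+ con (+ 1)) :* x :* c :* e :- d :* c :* c :- k :* e :* e) :+ c :* (d :* c :- k :* x :* e))
        := ((n :+ d) :* (n :+ d) :* (x :* x :- con (+ 1)) :+ n :* n) :* (c :* c)) refl x n′ d C E)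
      (trans (*-congʳ (sym S²)) (solve 2 (λ s c → s :* s :* (c :* c) := s :* c :* (s :* c)) refl S C)))))
    rhs : (S * C - n′ * x * C) * (n′ * x + S) ≈ d * (d + ι 2 * n′) * C * y
    rhs = trans (solve 4 (λ s c n x → (s :* c :- n :* x :* c) :* (n :* x :+ s) := (s :* s :- n :* n :* (x :* x)) :* c) refl S C n′ x)
      (trans (*-congʳ (+-congʳ S²))
      (solve 4 (λ x n d c → ((n :+ d) :* (n :+ d) :* (x :* x :- con (+ 1)) :+ n :* n :- n :* n :* (x :* x)) :* c
        := d :* (d :+ con (+ 2) :* n) :* c :* (x :* x :- con (+ 1))) refl x n′ d C))

  -- The hypothesis for (n + 1, d - 1) bounds C″ by C′, and the differential equation turns this
  -- into a lower bound of C by C′. The second conclusion forgets `S₁` in order to have the same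
  -- form as `lower-1≤x`.
  bound-x≤1 : ∀ {x S₀ S₁} → 0# < x → x ≤ 1# → 0# ≤ S₁ → S₀ ≤ S₁ → ∀ n m → let N = ι n + ι (suc m) in
    S₀ * S₀ ≈ N * N * (x * x - 1#) + ι n * ι n →
    S₁ * S₁ ≈ N * N * (x * x - 1#) + ι (suc n) * ι (suc n) →
    0# ≤ g x (suc (suc n)) (suc m) →
    Bound x S₁ (suc n) m →
    Bound x S₀ n (suc m)
    × ι 2 * ι (suc n) * g x (suc (suc n)) (suc m) * (ι (suc (suc n)) * x)
      ≤ ι (suc m) * (ι (suc m) + ι 2 * ι (suc n)) * g x (suc n) (suc (suc m))
  bound-x≤1 {x} {S₀} {S₁} 0<x x≤1 0≤S₁ S₀≤S₁ n m S₀² S₁² 0≤B IH =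
    -- By `lower` it remains to see (n x + S₀) (d + 2n + 2) ≤ (d + 2n) ((n + 2) x + S₁); the
    -- difference is (d + 2n) (S₁ - S₀) + 2 (N x - S₀).
    *-cancelʳ-≤ 0<e (≤-trans
      (≤-by (lB * ((d + ι 2 * n′) * (S₁ - S₀) + ι 2 * ((n′ + d) * x - S₀)))
        (0≤* 0≤lB (0≤+ (0≤* (0≤+ (0≤ι (suc m)) (0≤* (0≤ι 2) (0≤ι n))) (≤⇒0≤- S₀≤S₁))
          (0≤* (0≤ι 2) (≤⇒0≤- S₀≤Nx))))
        (solve 6 (λ x n d s t b → b :* (n :* x :+ s) :* (d :+ con (+ 2) :* (con (+ 1) :+ n))
            :+ b :* ((d :+ con (+ 2) :* n) :* (t :- s) :+ con (+ 2) :* ((n :+ d) :* x :- s))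
          := (d :+ con (+ 2) :* n) :* (b :* ((con (+ 1) :+ (con (+ 1) :+ n)) :* x :+ t))) refl x n′ d S₀ S₁ lB))
      (≤-respʳ (solve 4 (λ p d e a → p :* (d :* e :* a) := d :* p :* a :* e) refl (d + ι 2 * n′) d e A)
        (*-monoʳ-≤ (0≤+ (0≤ι (suc m)) (0≤* (0≤ι 2) (0≤ι n))) lower)))
    , ≤-trans (*-monoʳ-≤ 0≤lB (≤-by S₁ 0≤S₁ refl)) lower
    where
    n′ = ι n
    d  = ι (suc m)
    A  = g x (suc n) (suc (suc m))
    B  = g x (suc (suc n)) (suc m)
    D′ = ι 2 * ι (suc (suc n)) * g x (suc (suc (suc n))) m
    lB = ι 2 * ι (suc n) * B
    Z  = ι (suc n) * x + S₁
    0≤lB : 0# ≤ lB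
    0≤lB = 0≤* (0≤* (0≤ι 2) (0≤ι (suc n))) 0≤B
    0<Z : 0# < Z
    0<Z = 0<+ (*-pos (0<ι (suc n)) 0<x) 0≤S₁
    0≤1-x² : 0# ≤ 1# - x * x
    0≤1-x² = ≤⇒0≤- (≤-trans (*-monoʳ-≤ (<⇒≤ 0<x) x≤1) (≤-respˡ (sym (*-identityʳ x)) x≤1))
    -- With l = n + 1, (1 - x²) m (m + 2l) = (l x)² - S₁², so the factor `Z` = l x + S₁ cancels.
    [1-x²]D′≤ : (1# - x * x) * D′ ≤ (ι (suc n) * x - S₁) * B
    [1-x²]D′≤ = *-cancelʳ-≤ 0<Z (≤-respˡ (sym (*-assoc (1# - x * x) D′ Z)) (≤-respʳ
      (trans (solve 4 (λ x n m b → let l = con (+ 1) :+ n; N = n :+ (con (+ 1) :+ m) in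
          (con (+ 1) :- x :* x) :* (m :* (m :+ con (+ 2) :* l) :* b)
          := (l :* l :* (x :* x) :- (N :* N :* (x :* x :- con (+ 1)) :+ l :* l)) :* b) refl x n′ (ι m) B)
        (trans (*-congʳ (+-congˡ (-‿cong (sym S₁²))))
        (solve 4 (λ x l s b → (l :* l :* (x :* x) :- s :* s) :* b := (l :* x :- s) :* b :* (l :* x :+ s)) refl x (ι (suc n)) S₁ B)))
      (*-monoʳ-≤ 0≤1-x² IH)))
    e = d + ι 2 * ι (suc n)
    0<e : 0# < e
    0<e = 0<+ (0<ι (suc m)) (0≤* (0≤ι 2) (0≤ι (suc n)))
    S₀≤Nx : S₀ ≤ (n′ + d) * x
    S₀≤Nx = sq-cancel-≤ (0≤* (0≤+ (0≤ι n) (0≤ι (suc m))) (<⇒≤ 0<x))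
      (≤-by (d * (d + ι 2 * n′)) (0≤* (0≤ι (suc m)) (0≤+ (0≤ι (suc m)) (0≤* (0≤ι 2) (0≤ι n))))
      (trans (+-congʳ S₀²) (solve 3 (λ x n d → (n :+ d) :* (n :+ d) :* (x :* x :- con (+ 1)) :+ n :* n :+ d :* (d :+ con (+ 2) :* n)
        := (n :+ d) :* x :* ((n :+ d) :* x)) refl x n′ d)))
    lower : lB * (ι (suc (suc n)) * x + S₁) ≤ d * (d + ι 2 * ι (suc n)) * A
    lower = ≤-respʳ (sym (gegenbauer-ode x n m)) (≤-by
      (ι 2 * ι (suc n) * ((ι (suc n) * x - S₁) * B - (1# - x * x) * D′))
      (0≤* (0≤* (0≤ι 2) (0≤ι (suc n))) (≤⇒0≤- [1-x²]D′≤))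
      (solve 5 (λ x n s b D → let l = con (+ 1) :+ n in
        con (+ 2) :* l :* b :* ((con (+ 1) :+ l) :* x :+ s) :+ con (+ 2) :* l :* ((l :* x :- s) :* b :- (con (+ 1) :- x :* x) :* D)
        := con (+ 2) :* l :* ((con (+ 2) :* l :+ con (+ 1)) :* x :* b :+ (x :* x :- con (+ 1)) :* D)) refl x n′ S₁ B D′))

  -- All terms of the differential equation are nonnegative here; of its 2n + 3 copies of x C′ only
  -- n + 2 are kept, to match the case x ≤ 1.
  lower-1≤x : ∀ {x} → 1# ≤ x → ∀ n m →
    ι 2 * ι (suc n) * g x (suc (suc n)) (suc m) * (ι (suc (suc n)) * x)
      ≤ ι (suc m) * (ι (suc m) + ι 2 * ι (suc n)) * g x (suc n) (suc (suc m))
  lower-1≤x {x} 1≤x n m = ≤-respʳ (sym (gegenbauer-ode x n m)) (≤-by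
    (ι 2 * ι (suc n) * (ι (suc n) * x * B + (x * x - 1#) * D′))
    (0≤* (0≤* (0≤ι 2) (0≤ι (suc n)))
      (0≤+ (0≤* (0≤* (0≤ι (suc n)) (≤-trans (<⇒≤ 0<1) 1≤x)) (0≤g 1≤x (suc (suc n)) (suc m)))
        (0≤* (0≤x²-1 1≤x) (0≤* (0≤* (0≤ι 2) (0≤ι (suc (suc n)))) (0≤g 1≤x (suc (suc (suc n))) m)))))
    (solve 4 (λ x l b D → con (+ 2) :* l :* b :* ((con (+ 1) :+ l) :* x) :+ con (+ 2) :* l :* (l :* x :* b :+ (x :* x :- con (+ 1)) :* D)
      := con (+ 2) :* l :* ((con (+ 2) :* l :+ con (+ 1)) :* x :* b :+ (x :* x :- con (+ 1)) :* D)) refl x (ι (suc n)) B D′))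
    where
    B  = g x (suc (suc n)) (suc m)
    D′ = ι 2 * ι (suc (suc n)) * g x (suc (suc (suc n))) m

  module _ (x N : ℝ) (0<x : 0# < x) where

    radicand : ℕ → ℝ
    radicand n = N * N * (x * x - 1#) + ι n * ι n

    radicand-≤ : ∀ n → radicand n ≤ radicand (suc n)
    radicand-≤ n = ≤-by (1# + ι 2 * ι n) (0≤+ (<⇒≤ 0<1) (0≤* (0≤ι 2) (0≤ι n)))
      (solve 2 (λ y n → y :+ n :* n :+ (con (+ 1) :+ con (+ 2) :* n) := y :+ (con (+ 1) :+ n) :* (con (+ 1) :+ n)) refl _ (ι n))

    0<g∧bound : ∀ n d → ι n + ι d ≈ N → 0# < radicand n →
      0# < g x (suc n) (suc d) × Bound x (√ radicand n) n d
    0<g∧bound n zero    n+d≈N 0<rad = 0<1 ,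
      ≤-reflexive (solve 3 (λ a b c → a :* con (+ 0) :* b := con (+ 0) :* c :* con (+ 1)) refl _ _ _)
    0<g∧bound n (suc m) n+d≈N 0<rad = 0<A ,
      ≤-by-cases x 1# (λ x≤1 → proj₁ (near x≤1))
        (λ 1<x → bound-1<x 1<x (√-nonneg _) n m (square n 0<rad))
      where
      [1+n]+m≈N : ι (suc n) + ι m ≈ N
      [1+n]+m≈N = trans (solve 2 (λ n m → con (+ 1) :+ n :+ m := n :+ (con (+ 1) :+ m)) refl (ι n) (ι m)) n+d≈N
      0<rad⁺ = <-≤-trans 0<rad (radicand-≤ n)
      IH = 0<g∧bound (suc n) m [1+n]+m≈N 0<rad⁺
      S₀ = √ radicand n
      S₁ = √ radicand (suc n)
      square : ∀ k → 0# < radicand k → let N′ = ι n + ι (suc m) in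
        √ radicand k * √ radicand k ≈ N′ * N′ * (x * x - 1#) + ι k * ι k
      square k 0<rad = trans (√-square (<⇒≤ 0<rad)) (+-congʳ (*-congʳ (sym (*-cong n+d≈N n+d≈N))))
      S₀≤S₁ : S₀ ≤ S₁
      S₀≤S₁ = sq-cancel-≤ (√-nonneg _) (≤-respˡ (sym (√-square (<⇒≤ 0<rad)))
        (≤-respʳ (sym (√-square (<⇒≤ 0<rad⁺))) (radicand-≤ n)))
      near : x ≤ 1# → _
      near x≤1 = bound-x≤1 0<x x≤1 (√-nonneg _) S₀≤S₁ n m (square n 0<rad) (square (suc n) 0<rad⁺) (<⇒≤ (proj₁ IH)) (proj₂ IH)
      0<A : 0# < g x (suc n) (suc (suc m))
      -- Only the weak lower bound on a multiple of C is split at 1; strictness comes from the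
      -- induction hypothesis C′ > 0.
      0<A = 0<-cancelˡ (*-pos (0<ι (suc m)) (0<+ (0<ι (suc m)) (0≤* (0≤ι 2) (0≤ι (suc n)))))
        (<-≤-trans (*-pos (*-pos (*-pos 0<2′ (0<ι (suc n))) (proj₁ IH)) (*-pos (0<ι (suc (suc n))) 0<x))
          (≤-by-cases x 1# (λ x≤1 → proj₂ (near x≤1)) (λ 1<x → lower-1≤x (<⇒≤ 1<x) n m)))
        where 0<2′ = 0<ι 2

-- Continuity of polynomial functions.

module Continuity (R : RealNumbers) where
  open RealNumbers R hiding (zero)
  open OrderedFieldProperties R
  open Polynomials R
  open Naturals R
  open OrderedField R
  open ℤSolver using (solve; _:=_; _:+_; _:*_; _:-_; :-_; con)

  Within : ℝ → ℝ → Set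
  Within M y = - M < y × y < M

  within⇒0< : ∀ {M y} → Within M y → 0# < M
  within⇒0< {M} (-M<y , y<M) = 0<-cancelˡ 0<2 (<-respˡ (-‿inverseˡ M)
    (<-respʳ (solve 1 (λ M → M :+ M := (con (+ 1) :+ con (+ 1)) :* M) refl M) (+-monoˡ-< M (<-trans -M<y y<M))))

  within-+ : ∀ {A B x y} → Within A x → Within B y → Within (A + B) (x + y)
  within-+ {A} {B} {x} {y} (-A<x , x<A) (-B<y , y<B) =
    <-respˡ (solve 2 (λ a b → :- a :+ :- b := :- (a :+ b)) refl A B) (<-trans (+-monoˡ-< (- B) -A<x) (+-monoʳ-< x -B<y)) ,
    <-trans (+-monoˡ-< y x<A) (+-monoʳ-< A y<B)

  -- No case distinction on signs: 2 (A B + x y) = (A + x) (B + y) + (A - x) (B - y), and likewise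
  -- for A B - x y.
  within-* : ∀ {A B x y} → Within A x → Within B y → Within (A * B) (x * y)
  within-* {A} {B} {x} {y} (-A<x , x<A) (-B<y , y<B) =
    <-by (x * y - - (A * B)) (0<-cancelˡ 0<2 (<-respʳ
        (solve 4 (λ a b x y → (x :- :- a) :* (y :- :- b) :+ (a :- x) :* (b :- y) := (con (+ 1) :+ con (+ 1)) :* (x :* y :- :- (a :* b))) refl A B x y)
        (0<+ (*-pos (<⇒0<- -A<x) (<⇒0<- -B<y)) (<⇒≤ (*-pos (<⇒0<- x<A) (<⇒0<- y<B))))))
      (y-x+x _ _) ,
    <-by (A * B - x * y) (0<-cancelˡ 0<2 (<-respʳ
        (solve 4 (λ a b x y → (x :- :- a) :* (b :- y) :+ (a :- x) :* (y :- :- b) := (con (+ 1) :+ con (+ 1)) :* (a :* b :- x :* y)) refl A B x y)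
        (0<+ (*-pos (<⇒0<- -A<x) (<⇒0<- y<B)) (<⇒≤ (*-pos (<⇒0<- x<A) (<⇒0<- -B<y))))))
      (y-x+x _ _)

  within-resp : ∀ {M x y} → x ≈ y → Within M x → Within M y
  within-resp x≈y (-M<x , x<M) = <-respʳ x≈y -M<x , <-respˡ x≈y x<M

  within-exists : ∀ a → ∃ λ M → Within M a
  within-exists a with archimedean a | archimedean (- a)
  ... | n , a<n | m , -a<m = ι n + ι m ,
    <-respˡ (solve 3 (λ a n m → a :+ (:- (n :+ m) :- a) := :- (n :+ m)) refl a (ι n) (ι m))
      (<-respʳ (+-identityʳ a) (+-monoʳ-< a (<-respˡ (solve 3 (λ a n m → :- a :- (n :+ m) := :- (n :+ m) :- a) refl a (ι n) (ι m))
        (<-respʳ (-‿inverseʳ (ι n + ι m)) (+-monoˡ-< (- (ι n + ι m)) (<-≤-trans -a<m (≤-by (ι n) (0≤ι n) (+-comm _ _)))))))) ,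
    <-≤-trans a<n (≤-by (ι m) (0≤ι m) refl)

  local-factorisation : ∀ p a → Σ[ L ∈ ℝ ] ∀ y → Within 1# (y - a) →
    Σ[ q ∈ ℝ ] ⟦ p ⟧ y ≈ ⟦ p ⟧ a + (y - a) * q × Within L q
  local-factorisation [] a = 1# , λ y _ → 0# , solve 1 (λ h → con (+ 0) := con (+ 0) :+ h :* con (+ 0)) refl (y - a) ,
    (<-respʳ (-‿inverseˡ 1#) (<-respˡ (+-identityʳ _) (+-monoʳ-< (- 1#) 0<1)) , 0<1)
  local-factorisation (c ∷ p) a = M + (1# + A) * L , λ y h∈ → step y h∈ (factor y h∈)
    where
    L = proj₁ (local-factorisation p a)
    factor = proj₂ (local-factorisation p a)
    A = proj₁ (within-exists a)
    M = proj₁ (within-exists (⟦ p ⟧ a))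
    Factor : Poly → ℝ → ℝ → Set
    Factor p L y = Σ[ q ∈ ℝ ] ⟦ p ⟧ y ≈ ⟦ p ⟧ a + (y - a) * q × Within L q
    step : ∀ y → Within 1# (y - a) → Factor p L y → Factor (c ∷ p) (M + (1# + A) * L) y
    step y h∈ (q , py , q∈) = ⟦ p ⟧ a + y * q ,
      trans (+-congˡ (*-congˡ py))
        (solve 5 (λ a y c p q → c :+ y :* (p :+ (y :- a) :* q) := c :+ a :* p :+ (y :- a) :* (p :+ y :* q)) refl a y c (⟦ p ⟧ a) q) ,
      within-+ (proj₂ (within-exists (⟦ p ⟧ a))) (within-* y∈ q∈)
      where
      y∈ : Within (1# + A) y
      y∈ = within-resp (solve 2 (λ a y → y :- a :+ a := y) refl a y) (within-+ h∈ (proj₂ (within-exists a)))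

  abstract
    continuity : ∀ p a {δ} → 0# < δ → Σ[ ε ∈ ℝ ] 0# < ε × (∀ y → Within ε (y - a) → Within δ (⟦ p ⟧ y - ⟦ p ⟧ a))
    continuity p a {δ} 0<δ with local-factorisation p a
    ... | L , factor = ε , 0<ε , λ y h∈ →
      let q , py , q∈ = factor y (widen ε<1 h∈) in
      within-resp (sym (trans (+-congʳ py) (solve 2 (λ p h → p :+ h :- p := h) refl (⟦ p ⟧ a) _)))
        (widen εL<δ (within-* h∈ q∈))
      where
      0<L : 0# < L
      0<L = within⇒0< (proj₂ (proj₂ (factor a (within-resp (sym (-‿inverseʳ a)) 0∈))))
        where
        0∈ : Within 1# 0#
        0∈ = <-respʳ (-‿inverseˡ 1#) (<-respˡ (+-identityʳ _) (+-monoʳ-< (- 1#) 0<1)) , 0<1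
      widen : ∀ {A B y} → A < B → Within A y → Within B y
      widen {A} {B} A<B (-A<y , y<A) = <-trans (<-by (B - A) (<⇒0<- A<B) (solve 2 (λ a b → :- b :+ (b :- a) := :- a) refl A B)) -A<y , <-trans y<A A<B
      0<L+δ : 0# < L + δ
      0<L+δ = <-trans 0<L (x<x+y 0<δ)
      -- This choice gives both ε < 1, where the factorisation is valid, and ε L < δ.
      ε : ℝ
      ε = δ / L + δ ⟨ pos⇒#0 0<L+δ ⟩
      0<ε : 0# < ε
      0<ε = 0</ 0<δ 0<L+δ
      ε[L+δ]≈δ : ε * (L + δ) ≈ δ
      ε[L+δ]≈δ = /-* δ (L + δ) _
      ε<1 : ε < 1#
      ε<1 = *-cancelʳ-< 0<L+δ (<-respˡ (sym ε[L+δ]≈δ) (<-respʳ (sym (*-identityˡ _)) (y<x+y 0<L)))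
      εL<δ : ε * L < δ
      εL<δ = <-by (ε * δ) (*-pos 0<ε 0<δ) (trans (sym (distribˡ ε L δ)) ε[L+δ]≈δ)

  within-half : ∀ {ε a} → 0# < ε → Σ[ y ∈ ℝ ] a < y × Within ε (y - a)
  within-half {ε} {a} 0<ε with <-dense 0<ε
  ... | h , 0<h , h<ε = a + h , x<x+y 0<h , within-resp (solve 2 (λ a h → h := a :+ h :- a) refl a h)
    (<-trans (<-respˡ (+-identityʳ _) (<-respʳ (-‿inverseˡ ε) (+-monoʳ-< (- ε) 0<ε))) 0<h , h<ε)

-- Construction of the largest root by induction on the degree.

module LargestRoot (R : RealNumbers) (n : ℕ) where
  open RealNumbers R hiding (zero)
  open OrderedFieldProperties R
  open Naturals R
  open OrderedField R
  open Recurrence R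
  open Values R
  open CauchyTransformBound R
  open Continuity R
  open ℤSolver using (solve; _:=_; _:+_; _:*_; _:-_; :-_; con)

  c : ℕ → ℝ → ℝ
  c m x = g x (suc n) m

  c-continuity : ∀ m a {δ} → 0# < δ → Σ[ ε ∈ ℝ ] 0# < ε × (∀ y → Within ε (y - a) → Within δ (c m y - c m a))
  c-continuity m a 0<δ with continuity (G (suc n) m) a 0<δ
  ... | ε , 0<ε , near = ε , 0<ε , λ y y∈ →
    within-resp (+-cong (⟦G⟧ y (suc n) m) (-‿cong (⟦G⟧ a (suc n) m))) (near y y∈)

  c-neg-near : ∀ m a → c m a < 0# → Σ[ ε ∈ ℝ ] 0# < ε × (∀ y → Within ε (y - a) → c m y < 0#)
  c-neg-near m a ca<0 with c-continuity m a (<-respˡ (-‿inverseʳ _) (<-respʳ (+-identityˡ _) (+-monoˡ-< (- c m a) ca<0)))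
  ... | ε , 0<ε , near = ε , 0<ε , λ y y∈ → <-respˡ (y-x+x (c m a) (c m y))
    (<-respʳ (-‿inverseʳ (c m a)) (+-monoʳ-< (c m a) (proj₂ (near y y∈))))

  c-pos-near : ∀ m a → 0# < c m a → Σ[ ε ∈ ℝ ] 0# < ε × (∀ y → Within ε (y - a) → 0# < c m y)
  c-pos-near m a 0<ca with c-continuity m a 0<ca
  ... | ε , 0<ε , near = ε , 0<ε , λ y y∈ → <-respʳ (y-x+x (c m a) (c m y))
    (<-respˡ (-‿inverseʳ (c m a)) (+-monoʳ-< (c m a) (proj₁ (near y y∈))))

  -- Where `c m` is positive, W m x y > 0 says that c (suc m) / c m is larger at y than at x.
  W : ℕ → ℝ → ℝ → ℝ
  W m x y = c (suc m) y * c m x - c (suc m) x * c m y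

  -- Recursive form of the identity: cross-multiply `three-term` at y and at x and subtract.
  christoffel-darboux : ∀ m x y → ι (suc m) * W (suc m) x y
    ≈ ι 2 * (ι (suc m) + ι n) * ((y - x) * (c (suc m) x * c (suc m) y)) + (ι (suc m) + ι 2 * ι n) * W m x y
  christoffel-darboux m x y = trans
    (solve 5 (λ k a b c d → k :* (a :* b :- c :* d) := k :* a :* b :- k :* c :* d) refl (ι (suc m)) (c (suc (suc m)) y) (c (suc m) x) (c (suc (suc m)) x) (c (suc m) y))
    (trans (+-cong (*-congʳ (three-term y n m)) (-‿cong (*-congʳ (three-term x n m))))
    (solve 8 (λ x y n k a b p q →
        (con (+ 2) :* y :* (k :+ n) :* b :- (k :+ con (+ 2) :* n) :* q) :* a
        :- (con (+ 2) :* x :* (k :+ n) :* a :- (k :+ con (+ 2) :* n) :* p) :* b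
        := con (+ 2) :* (k :+ n) :* ((y :- x) :* (a :* b)) :+ (k :+ con (+ 2) :* n) :* (b :* p :- a :* q))
      refl x y (ι n) (ι (suc m)) (c (suc m) x) (c (suc m) y) (c m x) (c m y)))

  0<W : ∀ m {x y} → x < y → 0# < c (suc m) x → 0# < c (suc m) y → 0# ≤ W m x y → 0# < W (suc m) x y
  0<W m x<y 0<cx 0<cy 0≤W = 0<-cancelˡ (0<ι (suc m)) (<-respʳ (sym (christoffel-darboux m _ _))
    (0<+ (*-pos (*-pos (0<ι 2) (0<+ (0<ι (suc m)) (0≤ι n))) (*-pos (<⇒0<- x<y) (*-pos 0<cx 0<cy)))
      (0≤* (0≤+ (0≤ι (suc m)) (0≤* (0≤ι 2) (0≤ι n))) 0≤W)))

  -- monotone says that c (suc (suc m)) / c (suc m) increases to the right of r, so that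
  -- the set Left below, whose supremum is the root of the next polynomial, is located.
  record RightmostRoot (m : ℕ) : Set where
    field
      r         : ℝ
      c[r]≈0    : c (suc (suc m)) r ≈ 0#
      positive  : ∀ {x} → r < x → 0# < c (suc (suc m)) x
      previous  : 0# < c (suc m) r
      monotone  : ∀ {x y} → r < x → x < y → 0# ≤ W (suc m) x y

  rightmostRoot-0 : RightmostRoot 0
  rightmostRoot-0 = record
    { r        = 0#
    ; c[r]≈0   = trans (c₂≈ 0#) (zeroʳ _)
    ; positive = λ 0<x → <-respʳ (sym (c₂≈ _)) (*-pos (*-pos (0<ι 2) (0<+ (0<ι 1) (0≤ι n))) 0<x)
    ; previous = 0<1
    ; monotone = λ 0<x x<y → <⇒≤ (0<W 0 x<y 0<1 0<1
        (≤-reflexive (solve 0 (con (+ 0) := con (+ 1) :* con (+ 0) :- con (+ 1) :* con (+ 0)) refl)))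
    }
    where
    c₂≈ : ∀ x → c 2 x ≈ ι 2 * (ι 1 + ι n) * x
    c₂≈ x = trans (solve 1 (λ c → c := (con (+ 1) :+ con (+ 0)) :* c) refl (c 2 x)) (trans (three-term x n 0)
      (solve 4 (λ t k x z → t :* x :* k :* con (+ 1) :- z :* con (+ 0) := t :* k :* x) refl (ι 2) (ι 1 + ι n) x _))

  module Step {m : ℕ} (root : RightmostRoot m) where
    open RightmostRoot root

    p q : ℝ → ℝ
    p = c (suc (suc m))
    q = c (suc (suc (suc m)))

    -- Beyond `r` the quotient q / p increases, so there the negative values of `q` precede the
    -- positive ones. Adjoining all s ≤ r makes the set inhabited and hides the sign changes of `q`
    -- further left.
    Left : ℝ → Set
    Left s = s ≤ r ⊎ q s < 0#

    0<W⁺ : ∀ {x y} → r < x → x < y → q x * p y < q y * p x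
    0<W⁺ {x} {y} r<x x<y = <-by (W (suc (suc m)) x y)
      (0<W (suc m) x<y (positive r<x) (positive (<-trans r<x x<y)) (monotone r<x x<y)) (y-x+x _ _)

    positive⇒upperBound : ∀ {y} → r < y → 0# < q y → IsUpperBound Left y
    positive⇒upperBound r<y 0<qy s (inj₁ s≤r)  y<s = s≤r (<-trans r<y y<s)
    positive⇒upperBound {y} r<y 0<qy s (inj₂ qs<0) y<s = <-asym qs<0
      (0<-cancelˡ (positive r<y) (<-respʳ (*-comm _ _)
        (<-trans (*-pos 0<qy (positive (<-trans r<y y<s))) (0<W⁺ r<y y<s))))

    bounded : ∃ (IsUpperBound Left)
    bounded with archimedean r
    ... | k , r<k = ι (suc k) , λ
      { s (inj₁ s≤r)  k<s → s≤r (<-trans (<-trans r<k (y<x+y 0<1)) k<s)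
      ; s (inj₂ qs<0) k<s → 0≤g (<⇒≤ (≤-<-trans (≤-by (ι k) (0≤ι k) refl) k<s)) (suc n) (suc (suc (suc m))) qs<0 }

    Located : ℝ → ℝ → Set
    Located x y = (Σ[ s ∈ ℝ ] Left s × x < s) ⊎ IsUpperBound Left y

    sign-split : ∀ {x y w w′} → r < w → x < w → w < w′ → w′ < y →
      q w * p w′ < 0# ⊎ 0# < q w′ * p w → Located x y
    sign-split {w = w} r<w x<w w<w′ w′<y (inj₁ qw*pw′<0) = inj₁ (w , inj₂ qw<0 , x<w)
      where
      qw<0 : q w < 0#
      qw<0 = *-cancelʳ-< (positive (<-trans r<w w<w′)) (<-respʳ (sym (zeroˡ _)) qw*pw′<0)
    sign-split {w′ = w′} r<w x<w w<w′ w′<y (inj₂ 0<qw′*pw) = inj₂ λ s s∈ y<s →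
      positive⇒upperBound (<-trans r<w w<w′) 0<qw′ s s∈ (<-trans w′<y y<s)
      where
      0<qw′ : 0# < q w′
      0<qw′ = 0<-cancelˡ (positive r<w) (<-respʳ (*-comm _ _) 0<qw′*pw)

    -- The sign of `q` at one point is undecidable, but q w p w′ < q w′ p w is a strict gap:
    -- comparing it with 0 yields q w < 0 or q w′ > 0.
    located⁺ : ∀ {x y w} → r < w → x < w → w < y → Located x y
    located⁺ r<w x<w w<y =
      let _ , w<w′ , w′<y = <-dense w<y
      in sign-split r<w x<w w<w′ w′<y (<-cotrans (0<W⁺ r<w w<w′) 0#)

    located-right : ∀ {x y v} → x < y → r < v → v < y → r < x ⊎ x < v → Located x y
    located-right x<y r<v v<y (inj₁ r<x) = let w , x<w , w<y = <-dense x<y in located⁺ (<-trans r<x x<w) x<w w<y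
    located-right x<y r<v v<y (inj₂ x<v) = located⁺ r<v x<v v<y

    located : ∀ x y → x < y → Located x y
    located x y x<y with <-cotrans x<y r
    ... | inj₁ x<r = inj₁ (r , inj₁ <-irrefl , x<r)
    ... | inj₂ r<y = let _ , r<v , v<y = <-dense r<y in located-right x<y r<v v<y (<-cotrans r<v x)

    supremum : ∃ (IsSupremum Left)
    supremum = complete Left (r , inj₁ <-irrefl) bounded located

    r⁺ = proj₁ supremum
    left≤r⁺ = proj₁ (proj₂ supremum)

    -- By continuity `q` is still negative at some point to the right of `a`.
    q-neg⇒<r⁺ : ∀ {a} → q a < 0# → a < r⁺
    q-neg⇒<r⁺ qa<0 =
      let ε , 0<ε , near = c-neg-near (suc (suc (suc m))) _ qa<0
          y , a<y , y∈ = within-half 0<ε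
      in <-≤-trans a<y (left≤r⁺ y (inj₂ (near y y∈)))

    -- As p r ≈ 0, the three-term recurrence makes q r a negative multiple of c (suc m) r, which
    -- `previous` makes positive.
    r<r⁺ : r < r⁺
    r<r⁺ = q-neg⇒<r⁺ (*-cancelʳ-< 0<k (<-respʳ (sym (zeroˡ _)) (<-respˡ (sym q[r])
      (<-respʳ (-‿inverseˡ e) (<-respˡ (+-identityʳ _) (+-monoʳ-< (- e) 0<e))))))
      where
      e = (ι (suc (suc m)) + ι 2 * ι n) * c (suc m) r
      0<e : 0# < e
      0<e = *-pos (0<+ (0<ι (suc (suc m))) (0≤* (0≤ι 2) (0≤ι n))) previous
      0<k = 0<ι (suc (suc m))
      q[r] : q r * ι (suc (suc m)) ≈ - e
      q[r] = trans (*-comm _ _) (trans (three-term r n (suc m))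
        (trans (+-congʳ (trans (*-congˡ c[r]≈0) (zeroʳ _))) (+-identityˡ _)))

    -- Otherwise `q` is positive on an interval around `r⁺`, and no element of `Left` lies beyond a
    -- point close to `r⁺` on its left. Cotransitivity finds such a point that also exceeds `r`.
    q[r⁺]≤0 : q r⁺ ≤ 0#
    q[r⁺]≤0 0<q = approach (<-cotrans r<w (r⁺ - ε))
      where
      pos-near = c-pos-near (suc (suc (suc m))) r⁺ 0<q
      ε = proj₁ pos-near
      0<ε : 0# < ε
      0<ε = proj₁ (proj₂ pos-near)
      w = proj₁ (<-dense r<r⁺)
      r<w : r < w
      r<w = proj₁ (proj₂ (<-dense r<r⁺))
      w<r⁺ : w < r⁺
      w<r⁺ = proj₂ (proj₂ (<-dense r<r⁺))
      left-close : ∀ {x s} → r < x → r⁺ - ε ≤ x → ¬ (Left s × x < s)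
      left-close r<x r⁺-ε≤x (inj₁ s≤r , x<s) = s≤r (<-trans r<x x<s)
      left-close {s = s} r<x r⁺-ε≤x (inj₂ qs<0 , x<s) = <-asym qs<0 (proj₂ (proj₂ pos-near) s
        ( <-by (s - (r⁺ - ε)) (<⇒0<- (≤-<-trans r⁺-ε≤x x<s)) (solve 3 (λ s r e → :- e :+ (s :- (r :- e)) := s :- r) refl s r⁺ ε)
        , ≤-<-trans (≤-by (r⁺ - s) (≤⇒0≤- (left≤r⁺ s (inj₂ qs<0))) (solve 2 (λ s r → s :- r :+ (r :- s) := con (+ 0)) refl s r⁺)) 0<ε))
      no-left : ∀ {x} → r < x → r⁺ - ε ≤ x → ¬ (x < r⁺)
      no-left {x} r<x r⁺-ε≤x x<r⁺ = left-close r<x r⁺-ε≤x (proj₂ (proj₂ (proj₂ supremum) x x<r⁺))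
      approach : ¬ (r < r⁺ - ε ⊎ r⁺ - ε < w)
      approach (inj₁ r<r⁺-ε) = no-left r<r⁺-ε <-irrefl (<-by ε 0<ε (solve 2 (λ r e → r :- e :+ e := r) refl r⁺ ε))
      approach (inj₂ r⁺-ε<w) = no-left r<w (<⇒≤ r⁺-ε<w) w<r⁺

    q[r⁺]≈0 : q r⁺ ≈ 0#
    q[r⁺]≈0 = ≤-antisym q[r⁺]≤0 (λ q<0 → <-irrefl (q-neg⇒<r⁺ q<0))

    next : RightmostRoot (suc m)
    next = record
      { r        = r⁺
      ; c[r]≈0   = q[r⁺]≈0
      -- At an intermediate `z` the supremum gives only q z ≥ 0; strict growth of q / p makes q x
      -- positive.
      ; positive = λ {x} r⁺<x → let z , r⁺<z , z<x = <-dense r⁺<x in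
          0<-cancelˡ (positive (<-trans r<r⁺ r⁺<z)) (<-respʳ (*-comm _ _)
            (≤-<-trans (0≤* (λ qz<0 → left≤r⁺ z (inj₂ qz<0) r⁺<z) (<⇒≤ (positive (<-trans r<r⁺ r⁺<x))))
              (0<W⁺ (<-trans r<r⁺ r⁺<z) z<x)))
      ; previous = positive r<r⁺
      ; monotone = λ r⁺<x x<y → <⇒≤ (<⇒0<- (0<W⁺ (<-trans r<r⁺ r⁺<x) x<y))
      }

  rightmostRoot : ∀ m → RightmostRoot m
  rightmostRoot zero    = rightmostRoot-0
  rightmostRoot (suc m) = Step.next (rightmostRoot m)

-- The exact degree.

module Degree (R : RealNumbers) where
  open RealNumbers R hiding (zero)
  open OrderedFieldProperties R
  open Polynomials R
  open Naturals R
  open OrderedField R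
  open Recurrence R
  open ℤSolver using (solve; _:=_; _:+_; _:*_; _:-_; :-_; con)

  G-beyond : ∀ l m k → m ℕ.≤ k → coeff (G l m) k ≈ 0#
  G-beyond l       zero          k       m≤k       = refl
  G-beyond l       (suc zero)    (suc k) m≤k       = refl
  G-beyond zero    (suc (suc m)) k       m≤k       = refl
  G-beyond (suc l) (suc (suc m)) (suc k) (s≤s m<k) = trans (coeff-G l m (suc k))
    (trans (+-cong (*-congˡ (G-beyond (suc l) (suc m) k m<k))
      (+-cong (*-congˡ (G-beyond (suc l) m (suc k) (ℕ.≤-trans (ℕ.n≤1+n m) (ℕ.≤-trans m<k (ℕ.n≤1+n k)))))
        (G-beyond l (suc (suc m)) (suc k) (s≤s m<k))))
    (solve 1 (λ t → t :* con (+ 0) :+ (:- con (+ 1) :* con (+ 0) :+ con (+ 0)) := con (+ 0)) refl (ι 2)))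

  leading-step : ∀ l m → coeff (G (suc l) (suc (suc m))) (suc m)
    ≈ ι 2 * coeff (G (suc l) (suc m)) m + coeff (G l (suc (suc m))) (suc m)
  leading-step l m = trans (coeff-G l m (suc m)) (+-congˡ
    (trans (+-congʳ (trans (*-congˡ (G-beyond (suc l) m (suc m) (ℕ.n≤1+n m))) (zeroʳ _))) (+-identityˡ _)))

  0≤leading : ∀ l m → 0# ≤ coeff (G l (suc m)) m
  0≤leading l       zero    = <⇒≤ 0<1
  0≤leading zero    (suc m) = <-irrefl
  0≤leading (suc l) (suc m) = ≤-respʳ (sym (leading-step l m))
    (0≤+ (0≤* (0≤ι 2) (0≤leading (suc l) m)) (0≤leading l (suc m)))

  -- The doubled previous coefficient is positive by itself; the other summand is only nonnegative,
  -- since it vanishes for parameter 0.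
  0<leading : ∀ l m → 0# < coeff (G (suc l) (suc m)) m
  0<leading l zero    = 0<1
  0<leading l (suc m) = <-respʳ (sym (leading-step l m))
    (0<+ (*-pos (0<ι 2) (0<leading l m)) (0≤leading l (suc m)))

-- Transfer to the Gegenbauer polynomial and its Cauchy transform.

module GegenbauerBounds (R : RealNumbers) (n m : ℕ) where
  open RealNumbers R hiding (zero)
  open OrderedFieldProperties R
  open SquareRoot R
  open Polynomials R
  open Gegenbauer R
  open Naturals R
  open OrderedField R
  open Coefficients R
  open Recurrence R
  open Values R
  open CauchyTransformBound R
  open Degree R
  open ℤSolver using (solve; _:=_; _:+_; _:*_; _:-_; :-_; con)

  d : ℕ
  d = suc m

  C : Poly
  C = gegenbauer (ι (n ℕ.+ 1)) d

  N : ℝ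
  N = ι (n ℕ.+ d)

  C≋G : C ≋ G (suc n) (suc d)
  C≋G = ≡.subst (λ l → gegenbauer (ι l) d ≋ G (suc n) (suc d)) (ℕ.+-comm 1 n) (gegenbauer≋G (suc n) d)

  ⟦C⟧ : ∀ x → ⟦ C ⟧ x ≈ g x (suc n) (suc d)
  ⟦C⟧ x = trans (⟦⟧-cong {C} {G (suc n) (suc d)} C≋G x) (⟦G⟧ x (suc n) (suc d))

  ⟦C′⟧ : ∀ x → ⟦ C ′ ⟧ x ≈ ι 2 * ι (suc n) * g x (suc (suc n)) d
  ⟦C′⟧ x = trans (⟦⟧-cong {C ′} {G (suc n) (suc d) ′} (′-cong {C} {G (suc n) (suc d)} C≋G) x) (⟦G′⟧ x (suc n) d)

  nonconstant : Nonconstant C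
  nonconstant = record
    { deg     = d
    ; leading = pos⇒#0 (<-respʳ (sym (C≋G d)) (0<leading n d))
    ; beyond  = λ k d<k → trans (C≋G k) (G-beyond (suc n) (suc d) k d<k)
    }

  n+d≈N : ι n + ι d ≈ N
  n+d≈N = sym (ι-+ n d)

  0<N : 0# < N
  0<N = <-respʳ n+d≈N (≤-<-trans (0≤ι n) (x<x+y (0<ι d)))

  ρ : ℝ
  ρ = ι n * ι n / N * N ⟨ ι[n+d]²#0 n d ⟩

  ρN²≈n² : ρ * (N * N) ≈ ι n * ι n
  ρN²≈n² = /-* (ι n * ι n) (N * N) _

  0≤1-ρ : 0# ≤ 1# - ρ
  0≤1-ρ = 0≤-cancelˡ (*-pos 0<N 0<N) (≤-respʳ
    (trans (+-cong (*-cong n+d≈N n+d≈N) (-‿cong (sym ρN²≈n²)))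
      (solve 2 (λ N r → N :- r :* N := N :* (con (+ 1) :- r)) refl (N * N) ρ))
    (≤⇒0≤- (≤-trans (*-monoʳ-≤ (0≤ι n) n≤n+d) (*-monoˡ-≤ (0≤+ (0≤ι n) (0≤ι d)) n≤n+d))))
    where
    n≤n+d : ι n ≤ ι n + ι d
    n≤n+d = ≤-by (ι d) (0≤ι d) refl

  module _ {x : ℝ} (γ<x : γ n d < x) where

    S : ℝ
    S = √ (N * N * (x * x - 1#) + ι n * ι n)

    0<x : 0# < x
    0<x = ≤-<-trans (√-nonneg (1# - ρ)) γ<x

    -- The radicand is N² (x² - γ²), because γ² ≈ 1 - ρ.
    0<rad : 0# < N * N * (x * x - 1#) + ι n * ι n
    0<rad = <-respʳ
      (trans (solve 3 (λ N x r → N :* (x :- (con (+ 1) :- r)) := N :* (x :- con (+ 1)) :+ r :* N) refl (N * N) (x * x) ρ)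
        (+-congˡ ρN²≈n²))
      (*-pos (*-pos 0<N 0<N) (<⇒0<- (<-respˡ (√-square 0≤1-ρ) (sq-mono-≤-< (√-nonneg (1# - ρ)) γ<x))))

    S² : S * S ≈ N * N * (x * x - 1#) + ι n * ι n
    S² = √-square (<⇒≤ 0<rad)

    0<S : 0# < S
    0<S = 0<sq⇒0< (√-nonneg _) (<-respʳ (sym S²) 0<rad)

    0<den : 0# < ι n * x + S
    0<den = ≤-<-trans (0≤* (0≤ι n) (<⇒≤ 0<x)) (x<x+y 0<S)

    0<C : 0# < ⟦ C ⟧ x
    0<C = <-respʳ (sym (⟦C⟧ x)) (proj₁ (0<g∧bound x N 0<x n d n+d≈N 0<rad))

    C′≤ : ⟦ C ′ ⟧ x * (ι n * x + S) ≤ ι d * (ι d + ι 2 * ι n) * ⟦ C ⟧ x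
    C′≤ = ≤-respˡ (*-congʳ (sym (⟦C′⟧ x))) (≤-respʳ (*-congˡ (sym (⟦C⟧ x)))
      (proj₂ (0<g∧bound x N 0<x n d n+d≈N 0<rad)))

    2n+d≈ : ι (2 ℕ.* n ℕ.+ d) ≈ ι d + ι 2 * ι n
    2n+d≈ = trans (ι-+ (2 ℕ.* n) d) (trans (+-comm _ _) (+-congˡ (ι-* 2 n)))

    𝒢≤ : 𝒢 C nonconstant x (pos⇒#0 0<C) ≤ ι (2 ℕ.* n ℕ.+ d) / ι n * x + S ⟨ pos⇒#0 0<den ⟩
    𝒢≤ = *-cancelʳ-≤ (*-pos (*-pos (0<ι d) 0<C) 0<den) (≤-respˡ (sym lhs) (≤-respʳ (sym rhs) C′≤))
      where
      den = ι n * x + S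
      C[x] = ⟦ C ⟧ x
      a = 1# / ι d ⟨ ι#0 d ⟩
      b = ⟦ C ′ ⟧ x / C[x] ⟨ pos⇒#0 0<C ⟩
      e = ι (2 ℕ.* n ℕ.+ d) / den ⟨ pos⇒#0 0<den ⟩
      lhs : a * b * (ι d * C[x] * den) ≈ ⟦ C ′ ⟧ x * den
      lhs = trans (solve 5 (λ a b d c D → a :* b :* (d :* c :* D) := a :* d :* (b :* c) :* D) refl a b (ι d) C[x] den)
        (*-congʳ (trans (*-cong (/-* 1# (ι d) _) (/-* _ C[x] _)) (*-identityˡ _)))
      rhs : e * (ι d * C[x] * den) ≈ ι d * (ι d + ι 2 * ι n) * C[x]
      rhs = trans (solve 4 (λ e d c D → e :* (d :* c :* D) := d :* (e :* D) :* c) refl e (ι d) C[x] den)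
        (*-congʳ (*-congˡ (trans (/-* _ den _) 2n+d≈)))

    -- Cross-multiplication reduces this to (S - n x) (S + n x) = d (d + 2n) (x² - 1).
    bounds-agree : (D#0 : ι d * (x * x - 1#) # 0#) →
      ι (2 ℕ.* n ℕ.+ d) / ι n * x + S ⟨ pos⇒#0 0<den ⟩
        ≈ (- (ι n * x) + S) / ι d * (x * x - 1#) ⟨ D#0 ⟩
    bounds-agree D#0 = *-cancelʳ-# D#0 (*-cancelʳ-# (pos⇒#0 0<den) (trans
      (trans (solve 3 (λ e D q → e :* D :* q := e :* q :* D) refl e D den)
        (trans (*-congʳ (trans (/-* _ den _) 2n+d≈))
        (trans (solve 3 (λ x n d → (d :+ con (+ 2) :* n) :* (d :* (x :* x :- con (+ 1)))
            := (n :+ d) :* (n :+ d) :* (x :* x :- con (+ 1)) :+ n :* n :- n :* n :* (x :* x)) refl x (ι n) (ι d))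
        (trans (+-congʳ (trans (+-congʳ (*-congʳ (*-cong n+d≈N n+d≈N))) (sym S²)))
        (solve 3 (λ x n s → s :* s :- n :* n :* (x :* x) := (:- (n :* x) :+ s) :* (n :* x :+ s)) refl x (ι n) S)))))
      (*-congʳ (sym (/-* _ D D#0)))))
      where
      D = ι d * (x * x - 1#)
      den = ι n * x + S
      e = ι (2 ℕ.* n ℕ.+ d) / den ⟨ pos⇒#0 0<den ⟩

  open LargestRoot R n
  open RightmostRoot (rightmostRoot m)

  isMaxRoot : IsMaxRoot C r
  isMaxRoot = trans (⟦C⟧ r) c[r]≈0 ,
    λ s C[s]≈0 r<s → <⇒≉ (positive r<s) (sym (trans (sym (⟦C⟧ s)) C[s]≈0))

  maxRoot≤γ : r ≤ γ n d
  maxRoot≤γ γ<r = <⇒≉ (0<C γ<r) (sym (proj₁ isMaxRoot))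

corollary6p10 :
    (R : RealNumbers) →
    let open RealNumbers R
        open OrderedFieldProperties R
        open SquareRoot R
        open Polynomials R
        open Gegenbauer R
    in
    (n d : ℕ) .{{_ : NonZero d}} →
    let C = gegenbauer (ι (n ℕ.+ 1)) d
        root = λ (x : ℝ) → √ (ι (n ℕ.+ d) * ι (n ℕ.+ d) * (x * x - 1#) + ι n * ι n)
    in
    Σ[ nonconst ∈ Nonconstant C ]
      (Σ[ r ∈ ℝ ] IsMaxRoot C r × r ≤ γ n d)
      ×
      (∀ x → γ n d < x →
        Σ[ C[x]#0 ∈ ⟦ C ⟧ x # 0# ]
          ((d[x²-1]#0 : ι d * (x * x - 1#) # 0#) →
            𝒢 C nonconst x C[x]#0 ≤
              (- (ι n * x) + root x) / ι d * (x * x - 1#) ⟨ d[x²-1]#0 ⟩)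
          ×
          (Σ[ den#0 ∈ ι n * x + root x # 0# ]
            𝒢 C nonconst x C[x]#0 ≤
              ι (2 ℕ.* n ℕ.+ d) / ι n * x + root x ⟨ den#0 ⟩))
corollary6p10 R n (suc m) =
  nonconstant , (r , isMaxRoot , maxRoot≤γ) , λ x γ<x →
    pos⇒#0 (0<C γ<x) ,
    (λ D#0 → ≤-respʳ (bounds-agree γ<x D#0) (𝒢≤ γ<x)) ,
    pos⇒#0 (0<den γ<x) , 𝒢≤ γ<x
  where
  open RealNumbers R
  open OrderedFieldProperties R
  open OrderedField R
  open LargestRoot R n
  open RightmostRoot (rightmostRoot m)
  open GegenbauerBounds R n m
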